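{- Let $k,\ell\geq 1$ be integers and let $\mathbb{C}_{k,\ell}$ denote the set of cyclic permutations of $\{1,\ldots,(k-1)(\ell-1)+1\}$ that contain no increasing cyclic sub-permutation of length $k+1$ and no decreasing cyclic sub-permutation of length $\ell+1$. Then: (1) If $\min(k,\ell)\le 2$, then $|\mathbb{C}_{k,\ell}|=1$, and its single element is the decreasing cyclic permutation when $k\le 2$ and the increasing cyclic permutation when $k\ge 3$. (2) If $\min(k,\ell)\ge 3$, then $|\mathbb{C}_{k,\ell}|=2$, and a cyclic permutation $(1,a_1,\ldots,a_{(k-1)(\ell-1)})$ of $\{1,\ldots,(k-1)(\ell-1)+1\}$ belongs to $\mathbb{C}_{k,\ell}$ if and only if the sequence $a_1,\ldots,a_{(k-1)(\ell-1)}$ satisfies one of the following: (i) for each $(i,j)\in\{1,\ldots,\ell-1\}\times\{1,\ldots,k-1\}$, $a_{(j-1)(\ell-1)+i}=(\ell-1-i)(k-1)+j+1$; (ii) for each $(i,j)\in\{1,\ldots,\ell-1\}\times\{1,\ldots,k-1\}$, $a_{(i-1)(k-1)+j}=(j-1)(\ell-1)+(\ell-i)+1$.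
   Context: A cyclic permutation of a finite set of distinct integers is an arrangement of its elements in a circle, written $(j_1,\ldots,j_n)$, where two such expressions denote the same cyclic permutation if one is a cyclic rotation of the other; its length is $n$. Every cyclic permutation of $\{1,\ldots,N\}$ can be written uniquely starting with $1$. A cyclic sub-permutation of $\sigma$ is obtained by deleting some elements of $\sigma$ and keeping the rest in their cyclic order. A cyclic permutation is increasing if it can be written as $(j_1,\ldots,j_n)$ with $j_1<\cdots<j_n$, and decreasing if it can be written as $(j_1,\ldots,j_n)$ with $j_1>\cdots>j_n$. -}

module Defs where

open import Data.Nat using (ℕ; zero; suc; _+_; _*_; _∸_; _<_; _>_; _≤_)
open import Data.List using (List; []; _∷_; _++_; drop; take; length; map; upTo)
open import Data.List.Relation.Unary.Linked using (Linked)
open import Data.List.Relation.Binary.Sublist.Propositional using (_⊆_)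
open import Data.List.Relation.Binary.Permutation.Propositional using (_↭_)
open import Data.Maybe using (Maybe; just; nothing)
open import Data.Product using (Σ; ∃; _×_)
open import Relation.Binary.PropositionalEquality using (_≡_)
open import Relation.Nullary using (¬_)

[1‥_] : ℕ → List ℕ
[1‥ N ] = map suc (upTo N)

-- A cyclic permutation of {1..N} is represented by its unique linear
-- form starting with 1, i.e. by the list as with (1 ∷ as) a permutation
-- of [1..N].  (1 , as) represents the cyclic permutation (1, a₁, ..., a_{N-1}).
IsCycPerm : ℕ → List ℕ → Set
IsCycPerm N as = (1 ∷ as) ↭ [1‥ N ]

rotate : ℕ → List ℕ → List ℕ
rotate i s = drop i s ++ take i s

-- a cyclic permutation (given by any linear representative s) is
-- increasing / decreasing if some rotation of it is strictly monotone
IncreasingCyc : List ℕ → Set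
IncreasingCyc s = ∃ λ i → Linked _<_ (rotate i s)

DecreasingCyc : List ℕ → Set
DecreasingCyc s = ∃ λ i → Linked _>_ (rotate i s)

-- cyclic sub-permutations of the cyclic permutation represented by σ are
-- (the cyclic permutations represented by) sublists of σ
HasIncSub : ℕ → List ℕ → Set
HasIncSub m σ = ∃ λ s → s ⊆ σ × length s ≡ m × IncreasingCyc s

HasDecSub : ℕ → List ℕ → Set
HasDecSub m σ = ∃ λ s → s ⊆ σ × length s ≡ m × DecreasingCyc s

size : ℕ → ℕ → ℕ
size k ℓ = (k ∸ 1) * (ℓ ∸ 1) + 1

InC : ℕ → ℕ → List ℕ → Set
InC k ℓ as = IsCycPerm (size k ℓ) as
           × ¬ HasIncSub (suc k) (1 ∷ as)
           × ¬ HasDecSub (suc ℓ) (1 ∷ as)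

nth : List ℕ → ℕ → Maybe ℕ
nth [] _ = nothing
nth (x ∷ xs) zero = just x
nth (x ∷ xs) (suc n) = nth xs n

-- 1-based: a_m for as = a₁ ∷ a₂ ∷ ...
at : List ℕ → ℕ → Maybe ℕ
at as m = nth as (m ∸ 1)

CondI : ℕ → ℕ → List ℕ → Set
CondI k ℓ as = ∀ i j → 1 ≤ i → i ≤ ℓ ∸ 1 → 1 ≤ j → j ≤ k ∸ 1 →
  at as ((j ∸ 1) * (ℓ ∸ 1) + i) ≡ just ((ℓ ∸ 1 ∸ i) * (k ∸ 1) + j + 1)

CondII : ℕ → ℕ → List ℕ → Set
CondII k ℓ as = ∀ i j → 1 ≤ i → i ≤ ℓ ∸ 1 → 1 ≤ j → j ≤ k ∸ 1 →
  at as ((i ∸ 1) * (k ∸ 1) + j) ≡ just ((j ∸ 1) * (ℓ ∸ 1) + (ℓ ∸ i) + 1)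

{-# OPTIONS --safe #-}
-- Write K = k − 1, L = ℓ − 1, N = KL + 1. The extremal cyclic permutations are
-- the linear ones, a_p = 1 + (d p mod N) with a₀ = 1, for d = L (case (ii)) and
-- d = N − K (case (i)).
--
-- Linear ones are extremal: for suitable α, β with α + β = k (resp. ℓ) the
-- weight α p + β x of a position p with value x is a multiple of N, so that it
-- grows by at least N along each step of an increasing (resp. decreasing)
-- cyclic sequence, while its total growth around the circle is (α + β) N.
--
-- Extremal ones are linear: seen from any base point b, the other KL elements
-- have no increasing chain longer than K and no decreasing one longer than L,
-- so the lengths (U, V) of the longest such chains ending at an element label
-- them bijectively by [K] × [L]. Comparing the labels of all base points, a
-- maximal run b, b+1, …, b+n of cyclically increasing consecutive elements has
-- the same length for all b, and either all these runs or all decreasing runs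
-- are nontrivial. In the first case the labels fill the rectangle row by row,
-- n per row, which forces n = K; then the label (1, L), which belongs to the
-- successor of the value of b, sits at offset N − K for every b.
module Submission where

open import Defs
open import Data.Empty using (⊥)
open import Data.Fin as Fin using (Fin; toℕ; fromℕ<; combine; punchOut)
open import Data.Fin.Properties using (any?; injective⇒≤; punchOut-injective; combine-injective; fromℕ<-injective; toℕ<n; toℕ-injective)
open import Data.List using (List; []; _∷_; _++_; _∷ʳ_; length; map; take; drop; upTo; applyUpTo)
open import Data.List.Membership.Propositional using (_∈_)
open import Data.List.Membership.Propositional.Properties using (∈-∃++; ∈-applyUpTo⁺; ∈-applyUpTo⁻; ∈-++⁻; ∈-++⁺ˡ; ∈-++⁺ʳ)
open import Data.List.Properties using (++-assoc; ++-identityʳ; ∷-injectiveˡ; ∷-injectiveʳ; take++drop≡id; take-map; drop-map; map-++; map-upTo; applyUpTo-∷ʳ; length-++; length-map; length-applyUpTo)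
open import Data.List.Relation.Binary.Permutation.Propositional using (_↭_; ↭-refl; ↭-sym; ↭-trans; prep; ↭⇒↭ₛ)
open import Data.List.Relation.Binary.Permutation.Propositional.Properties using (↭-length; ∈-resp-↭; shift)
import Data.List.Relation.Binary.Permutation.Setoid.Properties as Permutationₛ
open import Data.List.Relation.Binary.Sublist.Propositional using (_⊆_; []; _∷_; ⊆-refl; ⊆-trans; minimum) renaming (_∷ʳ_ to skip)
open import Data.List.Relation.Binary.Sublist.Propositional.Properties using (++⁺; All-resp-⊆; length-mono-≤)
open import Data.List.Relation.Unary.All as All using (All; []; _∷_)
import Data.List.Relation.Unary.All.Properties as All
open import Data.List.Relation.Unary.AllPairs using (AllPairs; []; _∷_)
import Data.List.Relation.Unary.AllPairs.Properties as AllPairs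
open import Data.List.Relation.Unary.Any using (here; there)
open import Data.List.Relation.Unary.Linked as Linked using (Linked; []; [-]; _∷_)
import Data.List.Relation.Unary.Linked.Properties as Linked
open import Data.List.Relation.Unary.Unique.Propositional using (Unique)
import Data.List.Relation.Unary.Unique.Propositional.Properties as Unique
open import Data.Maybe using (just)
open import Data.Maybe.Properties using (just-injective)
open import Data.Nat
open import Data.Nat.Divisibility using (_∣_; divides; divides-refl; quotient; ∣m+n∣m⇒∣n; ∣⇒≤)
open import Data.Nat.DivMod using (_/_; _%_; m≡m%n+[m/n]*n; m%n<n; m<n⇒m%n≡m; [m+kn]%n≡m%n; m%n%n≡m%n; m*n%n≡0; m<n*o⇒m/o<n; %-distribˡ-+; %-distribˡ-*)
open import Data.Nat.Induction using (<-rec)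
open import Data.Nat.Properties
open import Data.Nat.Solver using (module +-*-Solver)
open import Data.Product using (∃; ∃₂; _×_; _,_; proj₁; proj₂)
open import Data.Sum using (_⊎_; inj₁; inj₂; [_,_]′; swap)
open import Function using (id; flip)
open import Function.Bundles using (_⇔_; mk⇔)
open import Function.Definitions using (Injective)
open import Relation.Binary.Definitions using (Tri; tri<; tri≈; tri>)
import Relation.Binary.Construct.Flip.EqAndOrd as Flip
open import Relation.Binary.PropositionalEquality
open import Relation.Binary.Structures using (IsStrictTotalOrder)
open import Relation.Nullary using (¬_; Dec; yes; no; contradiction)
open import Relation.Nullary.Decidable using (_×-dec_; _⊎-dec_; map′)

-- Lists

split-++ : ∀ {A : Set} (u {v} x {y} : List A) → u ++ v ≡ x ++ y →
  (∃ λ z → u ≡ x ++ z × y ≡ z ++ v) ⊎ (∃ λ z → x ≡ u ++ z × v ≡ z ++ y)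
split-++ []      x       eq   = inj₂ (x , refl , eq)
split-++ (a ∷ u) []      eq   = inj₁ (a ∷ u , refl , sym eq)
split-++ (a ∷ u) (b ∷ x) eq with refl ← ∷-injectiveˡ eq
  with split-++ u x (∷-injectiveʳ eq)
... | inj₁ (z , eq₁ , eq₂) = inj₁ (z , cong (a ∷_) eq₁ , eq₂)
... | inj₂ (z , eq₁ , eq₂) = inj₂ (z , cong (a ∷_) eq₁ , eq₂)

drop-length-++ : ∀ {A : Set} (x {y} : List A) → drop (length x) (x ++ y) ≡ y
drop-length-++ []      = refl
drop-length-++ (_ ∷ x) = drop-length-++ x

take-length-++ : ∀ {A : Set} (x {y} : List A) → take (length x) (x ++ y) ≡ x
take-length-++ []      = refl
take-length-++ (a ∷ x) = cong (a ∷_) (take-length-++ x)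

⊆-split-++ : ∀ {A : Set} {xs : List A} u {v} → xs ⊆ u ++ v →
             ∃₂ λ x y → xs ≡ x ++ y × x ⊆ u × y ⊆ v
⊆-split-++ []      s           = [] , _ , refl , minimum [] , s
⊆-split-++ (a ∷ u) (skip .a s)   with x , y , eq , sx , sy ← ⊆-split-++ u s = x , y , eq , skip a sx , sy
⊆-split-++ (a ∷ u) (refl ∷ s)  with x , y , eq , sx , sy ← ⊆-split-++ u s = a ∷ x , y , cong (a ∷_) eq , refl ∷ sx , sy

Linked-∷ʳ : ∀ {A : Set} {R : A → A → Set} (xs : List A) {a b} → Linked R (xs ∷ʳ a) → R a b → Linked R ((xs ∷ʳ a) ∷ʳ b)
Linked-∷ʳ []           [-]       r = r ∷ [-]
Linked-∷ʳ (x ∷ [])     (q ∷ [-]) r = q ∷ r ∷ [-]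
Linked-∷ʳ (x ∷ y ∷ xs) (q ∷ l)   r = q ∷ Linked-∷ʳ (y ∷ xs) l r

applyUpTo-mono : ∀ {A : Set} (f : ℕ → A) {p q} → p ≤ q → applyUpTo f p ⊆ applyUpTo f q
applyUpTo-mono f z≤n       = minimum _
applyUpTo-mono f (s≤s p≤q) = refl ∷ applyUpTo-mono (λ i → f (suc i)) p≤q

applyUpTo-cong : ∀ {A : Set} {f h : ℕ → A} n → (∀ {i} → i < n → f i ≡ h i) → applyUpTo f n ≡ applyUpTo h n
applyUpTo-cong zero    eq = refl
applyUpTo-cong (suc n) eq = cong₂ _∷_ (eq (s≤s z≤n)) (applyUpTo-cong n λ i<n → eq (s≤s i<n))

applyUpTo-+ : ∀ {A : Set} (f : ℕ → A) m n → applyUpTo f (m + n) ≡ applyUpTo f m ++ applyUpTo (λ i → f (m + i)) n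
applyUpTo-+ f zero    n = refl
applyUpTo-+ f (suc m) n = cong (f 0 ∷_) (applyUpTo-+ (λ i → f (suc i)) m n)

⊆-map⁻ : ∀ {A B : Set} (f : A → B) {xs} ys → xs ⊆ map f ys → ∃ λ zs → zs ⊆ ys × xs ≡ map f zs
⊆-map⁻ f []       []         = [] , [] , refl
⊆-map⁻ f (y ∷ ys) (skip _ s) with zs , t , eq ← ⊆-map⁻ f ys s = zs , skip y t , eq
⊆-map⁻ f (y ∷ ys) (refl ∷ s) with zs , t , eq ← ⊆-map⁻ f ys s = y ∷ zs , refl ∷ t , cong (f y ∷_) eq

AllPairs-resp-⊆ : ∀ {A : Set} {R : A → A → Set} {xs ys} → xs ⊆ ys → AllPairs R ys → AllPairs R xs
AllPairs-resp-⊆ []         []       = []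
AllPairs-resp-⊆ (skip _ s) (_ ∷ ps) = AllPairs-resp-⊆ s ps
AllPairs-resp-⊆ (refl ∷ s) (p ∷ ps) = All-resp-⊆ s p ∷ AllPairs-resp-⊆ s ps

last′ : ∀ {A : Set} → A → List A → A
last′ a []       = a
last′ a (b ∷ xs) = last′ b xs

Linked-++⁻ : ∀ {A : Set} {S : A → A → Set} a as {c cs} → Linked S (a ∷ as ++ c ∷ cs) →
             Linked S (a ∷ as) × S (last′ a as) c × Linked S (c ∷ cs)
Linked-++⁻ a []       (s ∷ l) = [-] , s , l
Linked-++⁻ a (b ∷ as) (s ∷ l) with l₁ , t , l₂ ← Linked-++⁻ b as l = s ∷ l₁ , t , l₂

All-last : ∀ {A : Set} {P : A → Set} {a as} → All P (a ∷ as) → P (last′ a as)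
All-last {as = []}    (p ∷ _)  = p
All-last {as = _ ∷ _} (_ ∷ ps) = All-last ps

-- Each head is cut out of `ys` where it occurs; uniqueness keeps the other entries inside what is
-- left.
unique-⊆⇒↭ : ∀ {A : Set} {xs ys : List A} → Unique xs → (∀ {x} → x ∈ xs → x ∈ ys) → length xs ≡ length ys → xs ↭ ys
unique-⊆⇒↭ {xs = []} {[]} _ _ _ = ↭-refl
unique-⊆⇒↭ {xs = x ∷ xs} (x∉ ∷ uniq) sub len with us , vs , refl ← ∈-∃++ (sub (here refl)) =
  ↭-trans (prep x (unique-⊆⇒↭ uniq sub′ (suc-injective (trans len len′)))) (↭-sym (shift x us vs))
  where
  len′ : length (us ++ x ∷ vs) ≡ suc (length (us ++ vs))
  len′ = ↭-length (shift x us vs)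
  sub′ : ∀ {y} → y ∈ xs → y ∈ us ++ vs
  sub′ y∈ with ∈-++⁻ us (sub (there y∈))
  ... | inj₁ y∈us         = ∈-++⁺ˡ y∈us
  ... | inj₂ (here refl)  = contradiction refl (All.lookup x∉ y∈)
  ... | inj₂ (there y∈vs) = ∈-++⁺ʳ us y∈vs

AllPairs-applyUpTo⁻ : ∀ {A : Set} {R : A → A → Set} (f : ℕ → A) n → AllPairs R (applyUpTo f n) →
                      ∀ {i j} → i < j → j < n → R (f i) (f j)
AllPairs-applyUpTo⁻ f (suc n) (r ∷ rs) {zero}  {suc j} _         (s≤s j<n) = All.applyUpTo⁻ _ n r j<n
AllPairs-applyUpTo⁻ f (suc n) (r ∷ rs) {suc i} {suc j} (s≤s i<j) (s≤s j<n) = AllPairs-applyUpTo⁻ _ n rs i<j j<n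

-- The default 0 is harmless: only indices below the length are ever read.
entry : List ℕ → ℕ → ℕ
entry []       _       = 0
entry (x ∷ xs) zero    = x
entry (x ∷ xs) (suc n) = entry xs n

applyUpTo-entry : ∀ xs → applyUpTo (entry xs) (length xs) ≡ xs
applyUpTo-entry []       = refl
applyUpTo-entry (x ∷ xs) = cong (x ∷_) (applyUpTo-entry xs)

nth-applyUpTo : ∀ f {m n} → m < n → nth (applyUpTo f n) m ≡ just (f m)
nth-applyUpTo f {zero}  (s≤s _)   = refl
nth-applyUpTo f {suc m} (s≤s m<n) = nth-applyUpTo (λ i → f (suc i)) m<n

nth-ext : ∀ xs ys → length xs ≡ length ys → (∀ {m} → m < length xs → nth xs m ≡ nth ys m) → xs ≡ ys
nth-ext []       []       _   _  = refl
nth-ext (x ∷ xs) (y ∷ ys) len eq =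
  cong₂ _∷_ (just-injective (eq (s≤s z≤n))) (nth-ext xs ys (suc-injective len) λ m<n → eq (s≤s m<n))

length-[1‥] : ∀ n → length [1‥ n ] ≡ n
length-[1‥] n = trans (length-map suc (upTo n)) (length-applyUpTo (λ i → i) n)

-- Residues

%-≢ : ∀ N .{{_ : NonZero N}} a {d} → 1 ≤ d → d < N → a % N ≢ (a + d) % N
%-≢ N a {d} 1≤d d<N eq = <⇒≱ d<N (∣⇒≤ {{>-nonZero 1≤d}} (∣m+n∣m⇒∣n (divides ((a + d) / N) sum) (divides-refl (a / N))))
  where
  sum : a / N * N + d ≡ (a + d) / N * N
  sum = +-cancelˡ-≡ (a % N) _ _ (begin
    a % N + (a / N * N + d)            ≡⟨ sym (+-assoc (a % N) _ d) ⟩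
    a % N + a / N * N + d              ≡⟨ cong (_+ d) (sym (m≡m%n+[m/n]*n a N)) ⟩
    a + d                              ≡⟨ m≡m%n+[m/n]*n (a + d) N ⟩
    (a + d) % N + (a + d) / N * N      ≡⟨ cong (_+ (a + d) / N * N) (sym eq) ⟩
    a % N + (a + d) / N * N            ∎)
    where open ≡-Reasoning

-- `c` inverts `d` modulo `N`, which recovers a position from its value in a linear sequence.
*-%-inverse : ∀ N .{{_ : NonZero N}} c d t → c * d ≡ 1 + t * N → ∀ p → (d * p % N * c) % N ≡ p % N
*-%-inverse N c d t cd≡1 p = begin
  (d * p % N * c) % N                       ≡⟨ %-distribˡ-* (d * p % N) c N ⟩
  ((d * p % N % N) * (c % N)) % N           ≡⟨ cong (λ x → (x * (c % N)) % N) (m%n%n≡m%n (d * p) N) ⟩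
  ((d * p % N) * (c % N)) % N               ≡⟨ sym (%-distribˡ-* (d * p) c N) ⟩
  (d * p * c) % N                           ≡⟨ cong (_% N) (solve 3 (λ c d p → d :* p :* c := c :* d :* p) refl c d p) ⟩
  (c * d * p) % N                           ≡⟨ cong (λ x → (x * p) % N) cd≡1 ⟩
  ((1 + t * N) * p) % N                     ≡⟨ cong (_% N) (solve 3 (λ t n p → (con 1 :+ t :* n) :* p := p :+ t :* p :* n) refl t N p) ⟩
  (p + t * p * N) % N                       ≡⟨ [m+kn]%n≡m%n p (t * p) N ⟩
  p % N                                     ∎
  where
  open ≡-Reasoning
  open +-*-Solver

-- Multiples of `N` are added on both sides so that congruences of either sign need no subtraction.
%-unique : ∀ N .{{_ : NonZero N}} a {y} s t → y < N → a + s * N ≡ y + t * N → a % N ≡ y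
%-unique N a {y} s t y<N eq = begin
  a % N             ≡⟨ sym ([m+kn]%n≡m%n a s N) ⟩
  (a + s * N) % N   ≡⟨ cong (_% N) eq ⟩
  (y + t * N) % N   ≡⟨ [m+kn]%n≡m%n y t N ⟩
  y % N             ≡⟨ m<n⇒m%n≡m y<N ⟩
  y                 ∎
  where open ≡-Reasoning

∣+*% : ∀ N .{{_ : NonZero N}} a β y s → a + β * y ≡ s * N → N ∣ a + β * (y % N)
∣+*% N a β y s eq = ∣m+n∣m⇒∣n (divides s (begin
  β * (y / N) * N + (a + β * (y % N))  ≡⟨ solve 5 (λ β q n a r → β :* q :* n :+ (a :+ β :* r) := a :+ β :* (r :+ q :* n)) refl β (y / N) N a (y % N) ⟩
  a + β * (y % N + y / N * N)          ≡⟨ cong (λ z → a + β * z) (sym (m≡m%n+[m/n]*n y N)) ⟩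
  a + β * y                            ≡⟨ eq ⟩
  s * N                                ∎)) (divides-refl (β * (y / N)))
  where
  open ≡-Reasoning
  open +-*-Solver

-- The complement `N ∸ y % N` plays the part of -y; it reverses the values in the decreasing case.
∣+*[N∸%] : ∀ N .{{_ : NonZero N}} a β y s → a + s * N ≡ β * y → N ∣ a + β * (N ∸ y % N)
∣+*[N∸%] N a β y s eq = ∣m+n∣m⇒∣n (divides (β * suc (y / N)) (begin
  s * N + (a + β * (N ∸ y % N))                 ≡⟨ solve 3 (λ s a b → s :+ (a :+ b) := a :+ s :+ b) refl (s * N) a _ ⟩
  a + s * N + β * (N ∸ y % N)                   ≡⟨ cong (_+ β * (N ∸ y % N)) (trans eq (cong (β *_) (m≡m%n+[m/n]*n y N))) ⟩
  β * (y % N + y / N * N) + β * (N ∸ y % N)     ≡⟨ solve 4 (λ β r q z → β :* (r :+ q) :+ β :* z := β :* (z :+ r :+ q)) refl β (y % N) (y / N * N) (N ∸ y % N) ⟩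
  β * (N ∸ y % N + y % N + y / N * N)           ≡⟨ cong (λ z → β * (z + y / N * N)) (m∸n+n≡m (<⇒≤ (m%n<n y N))) ⟩
  β * (suc (y / N) * N)                         ≡⟨ sym (*-assoc β (suc (y / N)) N) ⟩
  β * suc (y / N) * N                           ∎)) (divides-refl s)
  where
  open ≡-Reasoning
  open +-*-Solver

-- Erdős–Szekeres labels

-- U and V stand for the lengths of the longest increasing and decreasing chains
-- ending at an offset, where p ◁ q compares values.
record Labelling (M K L : ℕ) (_◁_ : ℕ → ℕ → Set) : Set where
  field
    U V    : ℕ → ℕ
    total  : ∀ {p q} → 1 ≤ p → p < q → q ≤ M → p ◁ q ⊎ q ◁ p
    U-mono : ∀ {p q} → 1 ≤ p → p < q → q ≤ M → p ◁ q → U p < U q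
    V-mono : ∀ {p q} → 1 ≤ p → p < q → q ≤ M → q ◁ p → V p < V q
    1≤U    : ∀ {p} → 1 ≤ p → p ≤ M → 1 ≤ U p
    1≤V    : ∀ {p} → 1 ≤ p → p ≤ M → 1 ≤ V p
    U≤K    : ∀ {p} → 1 ≤ p → p ≤ M → U p ≤ K
    V≤L    : ∀ {p} → 1 ≤ p → p ≤ M → V p ≤ L
    surj   : ∀ {u v} → 1 ≤ u → u ≤ K → 1 ≤ v → v ≤ L →
             ∃ λ p → 1 ≤ p × p ≤ M × U p ≡ u × V p ≡ v

  -- By totality the later of two positions exceeds the earlier one in `U` or in `V`.
  labels-≤⇒≤ : ∀ {p q} → 1 ≤ q → p ≤ M → U p ≤ U q → V p ≤ V q → p ≤ q
  labels-≤⇒≤ {p} {q} 1≤q p≤M Up≤Uq Vp≤Vq with p ≤? q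
  ... | yes p≤q = p≤q
  ... | no  p≰q with total 1≤q (≰⇒> p≰q) p≤M
  ...   | inj₁ q◁p = contradiction Up≤Uq (<⇒≱ (U-mono 1≤q (≰⇒> p≰q) p≤M q◁p))
  ...   | inj₂ p◁q = contradiction Vp≤Vq (<⇒≱ (V-mono 1≤q (≰⇒> p≰q) p≤M p◁q))

  -- The labels used up to any position form a Young diagram.
  diagram : ∀ {q u v} → 1 ≤ q → q ≤ M → 1 ≤ u → u ≤ U q → 1 ≤ v → v ≤ V q →
            ∃ λ p → 1 ≤ p × p ≤ q × U p ≡ u × V p ≡ v
  diagram 1≤q q≤M 1≤u u≤U 1≤v v≤V
    with p , 1≤p , p≤M , refl , refl ←
           surj 1≤u (≤-trans u≤U (U≤K 1≤q q≤M)) 1≤v (≤-trans v≤V (V≤L 1≤q q≤M))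
    = p , 1≤p , labels-≤⇒≤ 1≤q p≤M u≤U v≤V , refl , refl

  label-1 : 1 ≤ M → U 1 ≡ 1 × V 1 ≡ 1
  label-1 1≤M with diagram ≤-refl 1≤M ≤-refl (1≤U ≤-refl 1≤M) ≤-refl (1≤V ≤-refl 1≤M)
  ... | p , 1≤p , p≤1 , eU , eV with refl ← ≤-antisym p≤1 1≤p = eU , eV

module Chains (M : ℕ) {R : ℕ → ℕ → Set} (R? : ∀ p q → Dec (R p q)) where

  data Chain : ℕ → ℕ → Set where
    start  : ∀ {p} → 1 ≤ p → p ≤ M → Chain 1 p
    extend : ∀ {m p q} → Chain m p → p < q → q ≤ M → R p q → Chain (suc m) q

  chain? : ∀ m q → Dec (Chain m q)
  chain? zero q = no λ ()
  chain? (suc zero) q = map′ (λ (a , b) → start a b) (λ { (start a b) → a , b ; (extend () _ _ _) })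
    ((1 ≤? q) ×-dec (q ≤? M))
  chain? (suc (suc m)) q =
    map′ (λ (q≤M , p , p<q , r , c) → extend c p<q q≤M r) (λ { (extend c p<q q≤M r) → q≤M , _ , p<q , r , c })
      ((q ≤? M) ×-dec anyUpTo? (λ p → R? p q ×-dec chain? (suc m) p) q)

  -- The cap `k` makes the search for a longest chain finite; 0 means that no chain of length at
  -- most `k` ends at `p`.
  rank : ℕ → ℕ → ℕ
  rank zero    p = 0
  rank (suc k) p with chain? (suc k) p
  ... | yes _ = suc k
  ... | no  _ = rank k p

  rank≤ : ∀ k p → rank k p ≤ k
  rank≤ zero    p = z≤n
  rank≤ (suc k) p with chain? (suc k) p
  ... | yes _ = ≤-refl
  ... | no  _ = m≤n⇒m≤1+n (rank≤ k p)

  rank-chain : ∀ k p → 1 ≤ rank k p → Chain (rank k p) p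
  rank-chain (suc k) p 1≤r with chain? (suc k) p
  ... | yes c = c
  ... | no  _ = rank-chain k p 1≤r

  rank-max : ∀ {m} k p → m ≤ k → Chain m p → m ≤ rank k p
  rank-max zero p z≤n ()
  rank-max {m} (suc k) p m≤1+k c with chain? (suc k) p
  ... | yes _ = m≤1+k
  ... | no ¬c with m≤n⇒m<n∨m≡n m≤1+k
  ...   | inj₁ m<1+k = rank-max k p (≤-pred m<1+k) c
  ...   | inj₂ refl  = contradiction c ¬c

  module _ {k : ℕ} (bound : ∀ {p} → ¬ Chain (suc k) p) where

    rank-bounded : ∀ {m p} → m ≤ suc k → Chain m p → m ≤ rank k p
    rank-bounded {p = p} m≤1+k c with m≤n⇒m<n∨m≡n m≤1+k
    ... | inj₁ m<1+k = rank-max k p (≤-pred m<1+k) c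
    ... | inj₂ refl  = contradiction c bound

    1≤rank : ∀ {p} → 1 ≤ p → p ≤ M → 1 ≤ rank k p
    1≤rank 1≤p p≤M = rank-bounded (s≤s z≤n) (start 1≤p p≤M)

    rank-mono : ∀ {p q} → 1 ≤ p → p < q → q ≤ M → R p q → rank k p < rank k q
    rank-mono {p} 1≤p p<q q≤M r = rank-bounded (s≤s (rank≤ k p))
      (extend (rank-chain k p (1≤rank 1≤p (≤-trans (<⇒≤ p<q) q≤M))) p<q q≤M r)

-- If `t` were missed, punching it out would inject n + 1 elements into n.
injective⇒surjective : ∀ {n} {f : Fin n → Fin n} → Injective _≡_ _≡_ f → ∀ t → ∃ λ i → f i ≡ t
injective⇒surjective {suc n} {f} inj t with any? (λ i → f i Fin.≟ t)
... | yes hit = hit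
... | no miss = contradiction
      (injective⇒≤ {f = λ i → punchOut (t≢f i)} (λ {i} {j} eq → inj (punchOut-injective (t≢f i) (t≢f j) eq))) 1+n≰n
  where
  t≢f : ∀ i → t ≢ f i
  t≢f i t≡fi = miss (i , sym t≡fi)

module _ {K L : ℕ} {_◁_ : ℕ → ℕ → Set} (◁? : ∀ p q → Dec (p ◁ q)) where

  private
    M : ℕ
    M = K * L
    module IncChains = Chains M ◁?
    module DecChains = Chains M (flip ◁?)

  -- Of two offsets, the later one extends a longest chain of one kind ending at the earlier one, so
  -- labels are distinct. There are as many offsets as labels, namely K L, so every label occurs.
  erdős-szekeres-labelling :
    (∀ {p q} → 1 ≤ p → p < q → q ≤ M → p ◁ q ⊎ q ◁ p) →
    (∀ {p} → ¬ IncChains.Chain (suc K) p) → (∀ {p} → ¬ DecChains.Chain (suc L) p) →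
    Labelling M K L _◁_
  erdős-szekeres-labelling total ¬inc ¬dec = record
    { U      = U
    ; V      = V
    ; total  = total
    ; U-mono = U-mono
    ; V-mono = V-mono
    ; 1≤U    = 1≤U
    ; 1≤V    = 1≤V
    ; U≤K    = λ {p} _ _ → IncChains.rank≤ K p
    ; V≤L    = λ {p} _ _ → DecChains.rank≤ L p
    ; surj   = surj
    }
    where
    U V : ℕ → ℕ
    U = IncChains.rank K
    V = DecChains.rank L
    U-mono : ∀ {p q} → 1 ≤ p → p < q → q ≤ M → p ◁ q → U p < U q
    U-mono = IncChains.rank-mono ¬inc
    V-mono : ∀ {p q} → 1 ≤ p → p < q → q ≤ M → q ◁ p → V p < V q
    V-mono = DecChains.rank-mono ¬dec
    1≤U : ∀ {p} → 1 ≤ p → p ≤ M → 1 ≤ U p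
    1≤U = IncChains.1≤rank ¬inc
    1≤V : ∀ {p} → 1 ≤ p → p ≤ M → 1 ≤ V p
    1≤V = DecChains.1≤rank ¬dec

    label-injective : ∀ {p q} → 1 ≤ p → p < q → q ≤ M → U p ≡ U q → V p ≢ V q
    label-injective 1≤p p<q q≤M Ueq Veq with total 1≤p p<q q≤M
    ... | inj₁ r = <⇒≢ (U-mono 1≤p p<q q≤M r) Ueq
    ... | inj₂ r = <⇒≢ (V-mono 1≤p p<q q≤M r) Veq

    pred< : ∀ {m n} → 1 ≤ m → m ≤ n → pred m < n
    pred< {suc m} _ m≤n = m≤n

    pred-inj : ∀ {m n} → 1 ≤ m → 1 ≤ n → pred m ≡ pred n → m ≡ n
    pred-inj {suc m} {suc n} _ _ = cong suc

    pos : Fin M → ℕ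
    pos i = suc (toℕ i)

    U<K : ∀ i → pred (U (pos i)) < K
    U<K i = pred< (1≤U (s≤s z≤n) (toℕ<n i)) (IncChains.rank≤ K (pos i))

    V<L : ∀ i → pred (V (pos i)) < L
    V<L i = pred< (1≤V (s≤s z≤n) (toℕ<n i)) (DecChains.rank≤ L (pos i))

    -- Labels start at 1 and `Fin` at 0, hence the predecessors.
    code : Fin M → Fin M
    code i = combine (fromℕ< (U<K i)) (fromℕ< (V<L i))

    code-labels : ∀ {u v : ℕ} i (u<K : u < K) (v<L : v < L) → code i ≡ combine (fromℕ< u<K) (fromℕ< v<L) →
                  U (pos i) ≡ suc u × V (pos i) ≡ suc v
    code-labels i u<K v<L eq with eqU , eqV ← combine-injective (fromℕ< (U<K i)) (fromℕ< (V<L i)) _ _ eq =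
      pred-inj (1≤U (s≤s z≤n) (toℕ<n i)) (s≤s z≤n) (fromℕ<-injective _ _ (U<K i) u<K eqU) ,
      pred-inj (1≤V (s≤s z≤n) (toℕ<n i)) (s≤s z≤n) (fromℕ<-injective _ _ (V<L i) v<L eqV)

    code-injective : Injective _≡_ _≡_ code
    code-injective {i} {j} eq
      with Ui , Vi ← code-labels i (U<K j) (V<L j) eq | Uj , Vj ← code-labels j (U<K j) (V<L j) refl
      with <-cmp (toℕ i) (toℕ j)
    ... | tri< i<j _ _ = contradiction (trans Vi (sym Vj)) (label-injective (s≤s z≤n) (s≤s i<j) (toℕ<n j) (trans Ui (sym Uj)))
    ... | tri≈ _ i≡j _ = toℕ-injective i≡j
    ... | tri> _ _ j<i = contradiction (trans Vj (sym Vi)) (label-injective (s≤s z≤n) (s≤s j<i) (toℕ<n i) (trans Uj (sym Ui)))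

    surj : ∀ {u v} → 1 ≤ u → u ≤ K → 1 ≤ v → v ≤ L → ∃ λ p → 1 ≤ p × p ≤ M × U p ≡ u × V p ≡ v
    surj {suc u} {suc v} _ u<K _ v<L with i , eq ← injective⇒surjective code-injective (combine (fromℕ< u<K) (fromℕ< v<L)) =
      pos i , s≤s z≤n , toℕ<n i , code-labels i u<K v<L eq

-- Reversing the order exchanges the two kinds of chains, so the decreasing case can be read off the
-- increasing one.
Labelling-flip : ∀ {M K L _◁_} → Labelling M K L _◁_ → Labelling M L K (flip _◁_)
Labelling-flip lab = record
  { U = V ; V = U
  ; total = λ 1≤p p<q q≤M → swap (total 1≤p p<q q≤M)
  ; U-mono = V-mono ; V-mono = U-mono
  ; 1≤U = 1≤V ; 1≤V = 1≤U ; U≤K = V≤L ; V≤L = U≤K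
  ; surj = λ 1≤u u≤L 1≤v v≤K → let p , 1≤p , p≤M , eU , eV = surj 1≤v v≤K 1≤u u≤L in p , 1≤p , p≤M , eV , eU
  }
  where open Labelling lab

-- Labels of all rotations at once

-- The remainder runs through 1, ..., n, as a column number does; hence the division of p - 1.
decompose : ∀ n .{{_ : NonZero n}} p → 1 ≤ p → ∃ λ i → ∃ λ j → 1 ≤ i × i ≤ n × p ≡ i + j * n
decompose n (suc p) _ = suc (p % n) , p / n , s≤s z≤n , m%n<n p n , cong suc (m≡m%n+[m/n]*n p n)

-- `Q` is an abstract cyclic order on positions continued with period `suc M`, so that it can be
-- used again reversed, with `K` and `L` exchanged. Its totality comes from the labellings.
module CyclicLabels
  (M K L : ℕ) (M≡K*L : M ≡ K * L)
  (Q : ℕ → ℕ → ℕ → Set)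
  (rot  : ∀ {a b c} → Q a b c → Q b c a)
  (asym : ∀ {a b c} → Q a b c → ¬ Q a c b)
  (tran : ∀ {a b c d} → Q a b c → Q a c d → Q a b d)
  (unshift : ∀ m {a b c} → Q (m * suc M + a) (m * suc M + b) (m * suc M + c) → Q a b c)
  (labelling : ∀ b → Labelling M K L (λ p q → Q b (p + b) (q + b)))
  (2≤K : 2 ≤ K) (2≤L : 2 ≤ L)
  where

  module Lab b = Labelling (labelling b)

  -- `w` lies on the arc from `x` to `y` that avoids `b`, so the cyclic order is b, x, w, y.
  split-arc : ∀ {b x w y} → Q b x y → Q x w y → Q b x w × Q b w y
  split-arc bxy xwy =
    rot (rot (tran xwy (rot bxy))) ,
    rot (tran (rot (rot bxy)) (rot (rot xwy)))

  shift-frame : ∀ {b x y z} → Q b x y → Q b y z → Q x y z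
  shift-frame bxy byz = rot (rot (tran (rot byz) (rot (rot bxy))))

  K<M : K < M
  K<M = begin-strict
    K         <⟨ m<m+n K (≤-trans (s≤s z≤n) 2≤K) ⟩
    K + K     ≡⟨ cong (K +_) (sym (+-identityʳ K)) ⟩
    2 * K     ≤⟨ *-monoˡ-≤ K 2≤L ⟩
    L * K     ≡⟨ *-comm L K ⟩
    K * L     ≡⟨ sym M≡K*L ⟩
    M         ∎
    where open ≤-Reasoning

  1≤M : 1 ≤ M
  1≤M = ≤-trans (s≤s z≤n) K<M

  -- b, b+1, …, b+n is cyclically increasing.
  Run : ℕ → ℕ → Set
  Run b n = ∀ i → 1 ≤ i → i < n → Q b (i + b) (suc i + b)

  run-U : ∀ {b n} → Run b n → n ≤ M → ∀ i → 1 ≤ i → i ≤ n → i ≤ Lab.U b i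
  run-U {b} run n≤M (suc zero) _ 1≤n = Lab.1≤U b ≤-refl (≤-trans 1≤n n≤M)
  run-U {b} run n≤M (suc (suc i)) _ i<n =
    ≤-trans (s≤s (run-U run n≤M (suc i) (s≤s z≤n) (<⇒≤ i<n)))
            (Lab.U-mono b (s≤s z≤n) ≤-refl (≤-trans i<n n≤M) (run (suc i) (s≤s z≤n) i<n))

  run-head : ∀ {b n} → Run b n → ∀ i → 1 < i → i ≤ n → Q b (suc b) (i + b)
  run-head run (suc zero) (s≤s ()) _
  run-head run (suc (suc zero)) _ i≤n = run 1 ≤-refl i≤n
  run-head run (suc (suc (suc i))) _ i≤n =
    tran (run-head run (suc (suc i)) (s≤s (s≤s z≤n)) (<⇒≤ i≤n)) (run (suc (suc i)) (s≤s z≤n) i≤n)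

  run-suc : ∀ {b n} → Run b n → Q b (n + b) (suc n + b) → Run b (suc n)
  run-suc {n = n} run q i 1≤i i<1+n with m≤n⇒m<n∨m≡n (≤-pred i<1+n)
  ... | inj₁ i<n  = run i 1≤i i<n
  ... | inj₂ refl = q

  -- The drop gives offset n + 1 a `V` of at least 2, so the label (1,2) occurs no later than there.
  -- Along the run `U` is at least the offset, so among the first n offsets only offset 1 could
  -- carry it, and that has (1,1). Hence offset n + 1 has `U` equal to 1 and cannot lie above offset
  -- 1.
  run-end : ∀ {b n} → Run b n → 1 ≤ n → suc n ≤ M → Q b (suc n + b) (n + b) → Q b (suc n + b) (suc b)
  run-end {b} {n} run 1≤n n<M q
    with x , 1≤x , x≤1+n , Ux , Vx ← Lab.diagram b {suc n} {1} {2} (s≤s z≤n) n<M ≤-refl (Lab.1≤U b (s≤s z≤n) n<M) (s≤s z≤n)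
           (≤-trans (s≤s (Lab.1≤V b 1≤n (<⇒≤ n<M))) (Lab.V-mono b 1≤n ≤-refl n<M q))
    with m≤n⇒m<n∨m≡n x≤1+n
  ... | inj₁ x<1+n = contradiction (trans (sym Vx) (trans (cong (Lab.V b) x≡1) (proj₂ (Lab.label-1 b 1≤M)))) λ ()
    where
    x≡1 : x ≡ 1
    x≡1 = ≤-antisym (subst (x ≤_) Ux (run-U run (<⇒≤ n<M) x 1≤x (≤-pred x<1+n))) 1≤x
  ... | inj₂ refl with Lab.total b (s≤s z≤n) (s≤s 1≤n) n<M
  ...   | inj₁ r = contradiction (subst₂ _<_ (proj₁ (Lab.label-1 b 1≤M)) Ux (Lab.U-mono b ≤-refl (s≤s 1≤n) n<M r)) λ { (s≤s ()) }
  ...   | inj₂ r = r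

  -- Steps inside the run survive dropping `b`. Only the step from n to n + 1 is new: either it
  -- continues the run, or by `run-end` the order from `b` is n + 1, 1, n, which read from offset 1
  -- is 1, n, n + 1.
  run-step : ∀ {b n} → suc n ≤ M → Run b n → Run (suc b) n
  run-step {b} {n} n<M run i 1≤i i<n rewrite +-suc i b with m≤n⇒m<n∨m≡n i<n
  ... | inj₁ 1+i<n = shift-frame (run-head run (suc i) (s≤s 1≤i) (<⇒≤ 1+i<n)) (run (suc i) (s≤s z≤n) 1+i<n)
  ... | inj₂ refl with Lab.total b (s≤s z≤n) ≤-refl n<M
  ...   | inj₁ r = shift-frame (run-head run (suc i) (s≤s 1≤i) ≤-refl) r
  ...   | inj₂ r = rot (shift-frame (run-end run (s≤s z≤n) n<M r) (run-head run (suc i) (s≤s 1≤i) ≤-refl))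

  run-steps : ∀ {b n} → suc n ≤ M → Run b n → ∀ d → Run (d + b) n
  run-steps n<M run zero    = run
  run-steps n<M run (suc d) = run-step n<M (run-steps n<M run d)

  -- Stepping forward from b around the circle reaches b′ modulo the period.
  run-everywhere : ∀ {b n} → suc n ≤ M → Run b n → ∀ b′ → Run b′ n
  run-everywhere {b} {n} n<M run b′ i 1≤i i<n =
    unshift b (subst₂ (λ y z → Q (b * suc M + b′) y z) (reassoc i) (reassoc (suc i))
      (subst (λ x → Run x n) eq (run-steps n<M run (b′ + b * M)) i 1≤i i<n))
    where
    open +-*-Solver
    eq : b′ + b * M + b ≡ b * suc M + b′
    eq = solve 3 (λ b b′ M → b′ :+ b :* M :+ b := b :* (con 1 :+ M) :+ b′) refl b b′ M
    reassoc : ∀ i → i + (b * suc M + b′) ≡ b * suc M + (i + b′)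
    reassoc i = solve 3 (λ i x y → i :+ (x :+ y) := x :+ (i :+ y)) refl i (b * suc M) b′

  -- Filling the rectangle of labels row by row

  module Rows (n : ℕ) (2≤n : 2 ≤ n) (n≤K : n ≤ K)
    (runs : ∀ b → Run b n) (arc : ∀ b → Q b (suc n + b) (suc b)) (b : ℕ) where

    open Lab b

    instance
      n≢0 : NonZero n
      n≢0 = >-nonZero (≤-trans (s≤s z≤n) 2≤n)

    RowLabel : ℕ → Set
    RowLabel p = ∀ i j → 1 ≤ i → i ≤ n → p ≡ i + j * n → U p ≡ i × V p ≡ suc j

    RowsBelow : ℕ → Set
    RowsBelow p = ∀ {x} → x < p → RowLabel x

    label-position : ∀ {p x i j} → RowsBelow p → 1 ≤ x → x < p → U x ≡ i → V x ≡ suc j → x ≡ i + j * n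
    label-position {x = x} rows 1≤x x<p Ux Vx
      with i′ , j′ , 1≤i′ , i′≤n , eq ← decompose n x 1≤x
      with Ux′ , Vx′ ← rows x<p i′ j′ 1≤i′ i′≤n eq
      with refl ← trans (sym Ux′) Ux | refl ← trans (sym Vx′) Vx = eq

    -- By `diagram` the label (i, j+1) occurs no later than `p`; an earlier place would have to be i
    -- + j n, which is `p` itself.
    tight : ∀ {p} → RowsBelow p → p ≤ M → ∀ i j → 1 ≤ i → p ≡ i + j * n →
            i ≤ U p → suc j ≤ V p → U p ≡ i × V p ≡ suc j
    tight {p} rows p≤M i j 1≤i eq i≤U j<V
      with 1≤p ← subst (1 ≤_) (sym eq) (≤-trans 1≤i (m≤m+n i _))
      with x , 1≤x , x≤p , Ux , Vx ← diagram 1≤p p≤M 1≤i i≤U (s≤s z≤n) j<V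
      with m≤n⇒m<n∨m≡n x≤p
    ... | inj₁ x<p  = contradiction (trans (label-position rows 1≤x x<p Ux Vx) (sym eq)) (<⇒≢ x<p)
    ... | inj₂ refl = Ux , Vx

    -- Read at base x + b, `arc` puts offset n + 1 + x between x and x + 1; this ties each row to
    -- the previous one.
    arc-at : ∀ {p} x → p ≡ suc n + x → Q (x + b) (p + b) (suc x + b)
    arc-at x refl = subst (λ y → Q (x + b) y (suc x + b)) (cong suc (sym (+-assoc n x b))) (arc (x + b))

    row-increasing : ∀ {x} → 1 ≤ x → suc x ≤ M → V x ≡ V (suc x) → Q b (x + b) (suc x + b)
    row-increasing 1≤x x<M Vx with total 1≤x ≤-refl x<M
    ... | inj₁ r = r
    ... | inj₂ r = contradiction Vx (<⇒≢ (V-mono 1≤x ≤-refl x<M r))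

    -- Past the first row, p lies on the arc from x = p - n - 1 to z = x + 1. Inside a row these
    -- carry (i-1, j) and (i, j), and p beats x in `U` and z in `V`. At a row start with j ≥ 2, x
    -- ends one row and z starts the next, so the arc runs through the base: p comes before z, as
    -- desired, or after x, which is the exceptional case.
    label-bounds : ∀ {p} → RowsBelow p → p ≤ M → ∀ i j → 1 ≤ i → i ≤ n → p ≡ i + j * n →
      (i ≤ U p × suc j ≤ V p) ⊎ (i ≡ 1 × (∃ λ j′ → j ≡ suc (suc j′)) × n < U p)
    label-bounds rows p≤M i zero 1≤i i≤n refl rewrite +-identityʳ i =
      inj₁ (run-U (runs b) (≤-trans n≤K (<⇒≤ K<M)) i 1≤i i≤n , 1≤V 1≤i p≤M)
    -- Here x = 0 is the base itself, and `arc b` puts n + 1 before 1.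
    label-bounds {p} rows p≤M (suc zero) (suc zero) 1≤i i≤n eq
      with refl ← trans eq (cong suc (+-identityʳ n)) =
      inj₁ (1≤U (s≤s z≤n) p≤M ,
            subst (_< V (suc n)) (proj₂ (label-1 1≤M))
              (V-mono ≤-refl (s≤s (≤-trans (s≤s z≤n) 2≤n)) p≤M (arc b)))
    label-bounds {p} rows p≤M (suc zero) (suc (suc j)) 1≤i i≤n eq = go (total (s≤s z≤n) z<p p≤M)
      where
      x z : ℕ
      x = n + j * n
      z = suc x
      p≡ : p ≡ suc n + x
      p≡ = eq
      z<p : z < p
      z<p = subst (z <_) (sym p≡) (s≤s (m<n+m x (≤-trans (s≤s z≤n) 2≤n)))
      x<p = <-trans (n<1+n x) z<p
      1≤x : 1 ≤ x
      1≤x = ≤-trans (≤-trans (s≤s z≤n) 2≤n) (m≤m+n n _)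
      labx = rows x<p n j (≤-trans (s≤s z≤n) 2≤n) ≤-refl refl
      labz = rows z<p 1 (suc j) ≤-refl i≤n refl
      z◁x : Q b (z + b) (x + b)
      z◁x with total 1≤x ≤-refl (≤-trans (<⇒≤ z<p) p≤M)
      ... | inj₂ r = r
      ... | inj₁ r = contradiction (subst₂ _<_ (proj₁ labx) (proj₁ labz) (U-mono 1≤x ≤-refl (≤-trans (<⇒≤ z<p) p≤M) r))
                       (≤⇒≯ (≤-trans (s≤s z≤n) 2≤n))
      go : Q b (z + b) (p + b) ⊎ Q b (p + b) (z + b) →
           (1 ≤ U p × suc (suc (suc j)) ≤ V p) ⊎ (1 ≡ 1 × (∃ λ j′ → suc (suc j) ≡ suc (suc j′)) × n < U p)
      go (inj₂ p◁z) = inj₁ (1≤U (≤-trans (s≤s z≤n) z<p) p≤M , subst (_< V p) (proj₂ labz) (V-mono (s≤s z≤n) z<p p≤M p◁z))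
      go (inj₁ z◁p) with total 1≤x x<p p≤M
      ... | inj₁ x◁p = inj₂ (refl , (j , refl) , subst (_< U p) (proj₁ labx) (U-mono 1≤x x<p p≤M x◁p))
      ... | inj₂ p◁x = contradiction (shift-frame z◁p p◁x) (asym (rot (rot (arc-at x p≡))))
    label-bounds {p} rows p≤M (suc (suc i)) (suc j) 1≤i i≤n eq =
      inj₁ (subst (_< U p) (proj₁ labx) (U-mono (s≤s z≤n) x<p p≤M (proj₁ arcs)) ,
            subst (_< V p) (proj₂ labz) (V-mono (s≤s z≤n) z<p p≤M (proj₂ arcs)))
      where
      open +-*-Solver
      x z : ℕ
      x = suc i + j * n
      z = suc x
      p≡ : p ≡ suc n + x
      p≡ = trans eq (solve 3 (λ i j n → con 2 :+ i :+ (con 1 :+ j) :* n := con 1 :+ n :+ (con 1 :+ i :+ j :* n)) refl i j n)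
      z<p : z < p
      z<p = subst (z <_) (sym p≡) (s≤s (m<n+m x (≤-trans (s≤s z≤n) 2≤n)))
      x<p = <-trans (n<1+n x) z<p
      labx = rows x<p (suc i) j (s≤s z≤n) (<⇒≤ i≤n) refl
      labz = rows z<p (suc (suc i)) j (s≤s z≤n) i≤n refl
      arcs = split-arc (row-increasing (s≤s z≤n) (≤-trans (<⇒≤ z<p) p≤M) (trans (proj₂ labx) (sym (proj₂ labz)))) (arc-at x p≡)

    -- The bound on `U` rules out the exceptional case, so `tight` applies in a strong induction.
    rows-below : ∀ y → y ≤ suc M → (∀ {p} → 1 ≤ p → p < y → U p ≤ n) → RowsBelow y
    rows-below y y≤1+M U≤n {p} = <-rec (λ p → p < y → RowLabel p) step p
      where
      step : ∀ p → (∀ {x} → x < p → x < y → RowLabel x) → p < y → RowLabel p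
      step p rec p<y i j 1≤i i≤n eq
        with rows ← (λ {x} (x<p : x < p) → rec x<p (<-trans x<p p<y))
        with p≤M ← ≤-pred (≤-trans p<y y≤1+M)
        with label-bounds rows p≤M i j 1≤i i≤n eq
      ... | inj₁ (i≤U , j<V) = tight rows p≤M i j 1≤i eq i≤U j<V
      ... | inj₂ (refl , _ , n<U) = contradiction (U≤n (subst (1 ≤_) (sym eq) (s≤s z≤n)) p<y) (<⇒≱ n<U)

    -- Offset y + 1 lies between z and z + 1, labelled (1, j+2) and (2, j+2), so its label dominates
    -- (1, j+3). But y + 1 has `U` above 1, y has `U` equal to n + 1, and an earlier offset with
    -- that label would have to equal y.
    no-row-start : ∀ {y} j → RowsBelow y → y < M → U y ≡ suc n → y ≢ suc (suc (suc j) * n)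
    no-row-start {y} j rows y<M Uy eq = occupied (diagram (s≤s z≤n) y<M ≤-refl (<⇒≤ U>1) (s≤s z≤n) V>j)
      where
      z : ℕ
      z = suc (suc j * n)
      y≡ : y ≡ n + z
      y≡ = trans eq (sym (+-suc n _))
      1+z<y : suc z < y
      1+z<y = subst (suc z <_) (sym y≡) (+-monoˡ-≤ z 2≤n)
      z<y : z < y
      z<y = <-trans (n<1+n z) 1+z<y
      labz : U z ≡ 1 × V z ≡ suc (suc j)
      labz = rows z<y 1 (suc j) ≤-refl (≤-trans (s≤s z≤n) 2≤n) refl
      labz′ : U (suc z) ≡ 2 × V (suc z) ≡ suc (suc j)
      labz′ = rows 1+z<y 2 (suc j) (s≤s z≤n) 2≤n refl
      arcs : Q b (z + b) (suc y + b) × Q b (suc y + b) (suc z + b)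
      arcs = split-arc (row-increasing (s≤s z≤n) (≤-trans (<⇒≤ 1+z<y) (<⇒≤ y<M)) (trans (proj₂ labz) (sym (proj₂ labz′))))
               (arc-at z (cong suc y≡))
      U>1 : 1 < U (suc y)
      U>1 = subst (_< U (suc y)) (proj₁ labz) (U-mono (s≤s z≤n) (m≤n⇒m≤1+n z<y) y<M (proj₁ arcs))
      V>j : suc (suc j) < V (suc y)
      V>j = subst (_< V (suc y)) (proj₂ labz′) (V-mono (s≤s z≤n) (m≤n⇒m≤1+n 1+z<y) y<M (proj₂ arcs))
      occupied : ¬ (∃ λ x → 1 ≤ x × x ≤ suc y × U x ≡ 1 × V x ≡ suc (suc (suc j)))
      occupied (x , 1≤x , x≤1+y , Ux , Vx) with m≤n⇒m<n∨m≡n x≤1+y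
      ... | inj₂ refl = <⇒≢ U>1 (sym Ux)
      ... | inj₁ x<1+y with m≤n⇒m<n∨m≡n (≤-pred x<1+y)
      ...   | inj₂ refl = <⇒≢ (≤-trans (s≤s z≤n) 2≤n) (suc-injective (trans (sym Ux) Uy))
      ...   | inj₁ x<y = <⇒≢ x<y (trans (label-position rows 1≤x x<y Ux Vx) (sym eq))

    -- The label (K, L) dominates all others, so its offset has none after it.
    last-label : U M ≡ K × V M ≡ L
    last-label with surj (≤-trans (s≤s z≤n) 2≤K) ≤-refl (≤-trans (s≤s z≤n) 2≤L) ≤-refl
    ... | x , 1≤x , x≤M , Ux , Vx
      with refl ← ≤-antisym x≤M (labels-≤⇒≤ 1≤x ≤-refl (subst (U M ≤_) (sym Ux) (U≤K 1≤M ≤-refl))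
                                                       (subst (V M ≤_) (sym Vx) (V≤L 1≤M ≤-refl)))
      = Ux , Vx

    -- If n < K, let y be the place of the label (n+1,1). It starts a row
    -- j+1, and then no label fits y+1: the label (1,j+1) would have to occur
    -- before it.
    no-new-column : ∀ {y} → 1 ≤ y → y ≤ M → U y ≡ suc n → V y ≢ 1
    no-new-column {y} 1≤y y≤M Uy Vy = go (decompose n y 1≤y)
      where
      U≤n : ∀ {p} → 1 ≤ p → p < y → U p ≤ n
      U≤n {p} 1≤p p<y with U p ≤? n
      ... | yes Up≤n = Up≤n
      ... | no  Up≰n = contradiction (labels-≤⇒≤ 1≤p y≤M (subst (_≤ U p) (sym Uy) (≰⇒> Up≰n))
                        (subst (_≤ V p) (sym Vy) (1≤V 1≤p (≤-trans (<⇒≤ p<y) y≤M)))) (<⇒≱ p<y)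
      rows : RowsBelow y
      rows = rows-below y (m≤n⇒m≤1+n y≤M) U≤n
      y<M : y < M
      -- Offset y + 1 exists because the last label has `V` equal to L ≥ 2.
      y<M = ≤∧≢⇒< y≤M λ y≡M → <⇒≢ 2≤L (trans (sym Vy) (trans (cong V y≡M) (proj₂ last-label)))
      go : ¬ (∃ λ i → ∃ λ j → 1 ≤ i × i ≤ n × y ≡ i + j * n)
      go (i , j , 1≤i , i≤n , eq) with label-bounds rows y≤M i j 1≤i i≤n eq
      ... | inj₁ (i≤U , j<V) = 1+n≰n (subst (_≤ n) (trans (sym (proj₁ (tight rows y≤M i j 1≤i eq i≤U j<V))) Uy) i≤n)
      ... | inj₂ (refl , (j′ , refl) , _) = no-row-start j′ rows y<M Uy eq

    ¬n<K : ¬ n < K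
    ¬n<K n<K with surj {suc n} {1} (s≤s z≤n) n<K ≤-refl (≤-trans (s≤s z≤n) 2≤L)
    ... | y , 1≤y , y≤M , Uy , Vy = no-new-column 1≤y y≤M Uy Vy

  arcs-at-maximal-run : ∀ {n} → 1 ≤ n → suc n ≤ M → (∀ b → Run b n) → (∀ b → ¬ Run b (suc n)) →
                        ∀ b → Q b (suc n + b) (suc b)
  arcs-at-maximal-run 1≤n n<M runs ¬run b with Lab.total b 1≤n ≤-refl n<M
  ... | inj₁ r = contradiction (run-suc (runs b) r) (¬run b)
  ... | inj₂ r = run-end (runs b) 1≤n n<M r

  -- An increasing step at base 0 lengthens the run there, hence everywhere. A decreasing one
  -- excludes longer runs at every base, since they would spread to 0; rows of length n < K then
  -- fill the rectangle, which is impossible.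
  run-extend : ∀ n → 2 ≤ n → n < K → (∀ b → Run b n) → ∀ b → Run b (suc n)
  run-extend n 2≤n n<K runs with Lab.total 0 (≤-trans (s≤s z≤n) 2≤n) ≤-refl (<-trans n<K K<M)
  ... | inj₁ r = run-everywhere (≤-trans (s≤s n<K) K<M) (run-suc (runs 0) r)
  ... | inj₂ r = contradiction n<K (Rows.¬n<K n 2≤n (<⇒≤ n<K) runs
      (arcs-at-maximal-run 1≤n (<-trans n<K K<M) runs
        λ b run → asym r (run-everywhere (≤-trans (s≤s n<K) K<M) run 0 n 1≤n ≤-refl)) 0)
    where 1≤n = ≤-trans (s≤s z≤n) 2≤n

  runs-upto : ∀ n → 2 ≤ n → n ≤ K → (∀ b → Run b 2) → ∀ b → Run b n
  runs-upto (suc zero) (s≤s ()) _ _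
  runs-upto (suc (suc zero)) 2≤n n≤K runs = runs
  runs-upto (suc (suc (suc n))) 2≤n n≤K runs =
    run-extend (suc (suc n)) (s≤s (s≤s z≤n)) n≤K (runs-upto (suc (suc n)) (s≤s (s≤s z≤n)) (<⇒≤ n≤K) runs)

  -- Runs reach length K, so the rows fill the whole rectangle and offset N - K gets the label (1,
  -- L). Seen from `b`, a smaller element before it would force `U` above 1, and one after it would
  -- have `V` above L.
  next-value : Q 0 1 2 → ∀ b {x} → 1 ≤ x → x ≤ M → ¬ Q b (x + b) (suc (pred L * K) + b)
  next-value q b {x} 1≤x x≤M r = no-smaller (<-cmp x p₀)
    where
    runs₂ : ∀ b → Run b 2
    runs₂ = run-everywhere (≤-trans (s≤s 2≤K) K<M) λ { (suc zero) _ _ → q ; (suc (suc _)) _ (s≤s (s≤s ())) }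
    runs = runs-upto K 2≤K ≤-refl runs₂
    1≤K = ≤-trans (s≤s z≤n) 2≤K
    -- A run of length K + 1 would end with `U` above K, so these runs are maximal.
    arc = arcs-at-maximal-run 1≤K K<M runs λ b run →
      1+n≰n (≤-trans (run-U run K<M (suc K) (s≤s z≤n) ≤-refl) (Lab.U≤K b (s≤s z≤n) K<M))
    open Lab b
    p₀ = suc (pred L * K)
    L≡ : suc (pred L) ≡ L
    L≡ = suc-pred L {{>-nonZero (≤-trans (s≤s z≤n) 2≤L)}}
    p₀≤M : p₀ ≤ M
    p₀≤M = begin
      suc (pred L * K) ≤⟨ +-monoˡ-≤ (pred L * K) 1≤K ⟩
      K + pred L * K   ≡⟨⟩
      suc (pred L) * K ≡⟨ cong (_* K) L≡ ⟩
      L * K            ≡⟨ *-comm L K ⟩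
      K * L            ≡⟨ sym M≡K*L ⟩
      M                ∎
      where open ≤-Reasoning
    label-p₀ : U p₀ ≡ 1 × V p₀ ≡ suc (pred L)
    label-p₀ = Rows.rows-below K 2≤K ≤-refl runs arc b (suc M) ≤-refl
      (λ 1≤p p<1+M → U≤K 1≤p (≤-pred p<1+M)) (s≤s p₀≤M) 1 (pred L) ≤-refl 1≤K refl
    no-smaller : Tri (x < p₀) (x ≡ p₀) (p₀ < x) → ⊥
    no-smaller (tri< x<p₀ _ _) = <⇒≱ (U-mono 1≤x x<p₀ p₀≤M r) (subst (_≤ U x) (sym (proj₁ label-p₀)) (1≤U 1≤x x≤M))
    no-smaller (tri≈ _ refl _) = asym r r
    no-smaller (tri> _ _ p₀<x) = <⇒≱ (V-mono (s≤s z≤n) p₀<x x≤M r) (subst (V x ≤_) (sym (trans (proj₂ label-p₀) L≡)) (V≤L 1≤x x≤M))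

-- Cyclic orders

module Cyclic (_≺_ : ℕ → ℕ → Set) (isSTO : IsStrictTotalOrder _≡_ _≺_) where
  open IsStrictTotalOrder isSTO using () renaming (compare to ≺-cmp; _<?_ to _≺?_; trans to ≺-trans; asym to ≺-asym; irrefl to ≺-irrefl)

  C : ℕ → ℕ → ℕ → Set
  C a b c = (a ≺ b × b ≺ c) ⊎ (b ≺ c × c ≺ a) ⊎ (c ≺ a × a ≺ b)

  C? : ∀ a b c → Dec (C a b c)
  C? a b c = ((a ≺? b) ×-dec (b ≺? c)) ⊎-dec (((b ≺? c) ×-dec (c ≺? a)) ⊎-dec ((c ≺? a) ×-dec (a ≺? b)))

  C-rot : ∀ {a b c} → C a b c → C b c a
  C-rot (inj₁ (p , q))        = inj₂ (inj₂ (p , q))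
  C-rot (inj₂ (inj₁ (p , q))) = inj₁ (p , q)
  C-rot (inj₂ (inj₂ (p , q))) = inj₂ (inj₁ (p , q))

  C-asym : ∀ {a b c} → C a b c → ¬ C a c b
  C-asym (inj₁ (p , q))        (inj₁ (r , s))        = ≺-asym q s
  C-asym (inj₁ (p , q))        (inj₂ (inj₁ (r , s))) = ≺-asym q r
  C-asym (inj₁ (p , q))        (inj₂ (inj₂ (r , s))) = ≺-asym p r
  C-asym (inj₂ (inj₁ (p , q))) (inj₁ (r , s))        = ≺-asym p s
  C-asym (inj₂ (inj₁ (p , q))) (inj₂ (inj₁ (r , s))) = ≺-asym p r
  C-asym (inj₂ (inj₁ (p , q))) (inj₂ (inj₂ (r , s))) = ≺-asym q s
  C-asym (inj₂ (inj₂ (p , q))) (inj₁ (r , s))        = ≺-asym p r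
  C-asym (inj₂ (inj₂ (p , q))) (inj₂ (inj₁ (r , s))) = ≺-asym q s
  C-asym (inj₂ (inj₂ (p , q))) (inj₂ (inj₂ (r , s))) = ≺-asym p s

  C-trans : ∀ {a b c d} → C a b c → C a c d → C a b d
  C-trans (inj₁ (p , q))        (inj₁ (r , s))        = inj₁ (p , ≺-trans q s)
  C-trans (inj₁ (p , q))        (inj₂ (inj₁ (r , s))) = inj₂ (inj₂ (s , p))
  C-trans (inj₁ (p , q))        (inj₂ (inj₂ (r , s))) = inj₂ (inj₂ (r , p))
  C-trans (inj₂ (inj₁ (p , q))) (inj₁ (r , s))        = contradiction q (≺-asym r)
  C-trans (inj₂ (inj₁ (p , q))) (inj₂ (inj₁ (r , s))) = inj₂ (inj₁ (≺-trans p r , s))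
  C-trans (inj₂ (inj₁ (p , q))) (inj₂ (inj₂ (r , s))) = contradiction q (≺-asym s)
  C-trans (inj₂ (inj₂ (p , q))) (inj₁ (r , s))        = contradiction p (≺-asym r)
  C-trans (inj₂ (inj₂ (p , q))) (inj₂ (inj₁ (r , s))) = inj₂ (inj₂ (s , q))
  C-trans (inj₂ (inj₂ (p , q))) (inj₂ (inj₂ (r , s))) = contradiction p (≺-asym s)

  C-total : ∀ {a b c} → a ≢ b → a ≢ c → b ≢ c → C a b c ⊎ C a c b
  C-total {a} {b} {c} a≢b a≢c b≢c with ≺-cmp a b | ≺-cmp a c | ≺-cmp b c
  ... | tri≈ _ e _ | _          | _          = contradiction e a≢b
  ... | _          | tri≈ _ e _ | _          = contradiction e a≢c
  ... | _          | _          | tri≈ _ e _ = contradiction e b≢c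
  ... | tri< p _ _ | tri< q _ _ | tri< r _ _ = inj₁ (inj₁ (p , r))
  ... | tri< p _ _ | tri< q _ _ | tri> _ _ r = inj₂ (inj₁ (q , r))
  ... | tri< p _ _ | tri> _ _ q | _          = inj₁ (inj₂ (inj₂ (q , p)))
  ... | tri> _ _ p | tri< q _ _ | _          = inj₂ (inj₂ (inj₂ (p , q)))
  ... | tri> _ _ p | tri> _ _ q | tri< r _ _ = inj₁ (inj₂ (inj₁ (r , q)))
  ... | tri> _ _ p | tri> _ _ q | tri> _ _ r = inj₂ (inj₂ (inj₁ (r , p)))

  C-irrefl : ∀ {a c} → ¬ C a a c
  C-irrefl (inj₁ (p , q))        = ≺-irrefl refl p
  C-irrefl (inj₂ (inj₁ (p , q))) = ≺-asym p q
  C-irrefl (inj₂ (inj₂ (p , q))) = ≺-irrefl refl q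

  CycSorted : List ℕ → Set
  CycSorted s = ∃ λ i → Linked _≺_ (rotate i s)

  cycSorted⁺ : ∀ x y → Linked _≺_ (y ++ x) → CycSorted (x ++ y)
  cycSorted⁺ x y l = length x , subst₂ (λ a b → Linked _≺_ (a ++ b)) (sym (drop-length-++ x)) (sym (take-length-++ x)) l

  -- The sorted rotation cuts inside `u` or inside `v`; either way it is a rotation of `v ++ u` too.
  cycSorted-swap : ∀ u v → CycSorted (u ++ v) → CycSorted (v ++ u)
  cycSorted-swap u v (i , l) with split-++ u (take i (u ++ v)) (sym (take++drop≡id i (u ++ v)))
  ... | inj₁ (z , eq₁ , eq₂) = subst CycSorted (trans (++-assoc v _ z) (cong (v ++_) (sym eq₁)))
          (cycSorted⁺ (v ++ take i (u ++ v)) z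
            (subst (Linked _≺_) (trans (cong (_++ take i (u ++ v)) eq₂) (++-assoc z v _)) l))
  ... | inj₂ (z , eq₁ , eq₂) = subst CycSorted (trans (sym (++-assoc z _ u)) (cong (_++ u) (sym eq₂)))
          (cycSorted⁺ z (drop i (u ++ v) ++ u)
            (subst (Linked _≺_) (trans (cong (drop i (u ++ v) ++_) eq₁) (sym (++-assoc _ u z))) l))

  private
    below : ∀ {x y ys} → y ≺ x → Linked (C x) (y ∷ ys) → All (_≺ x) (y ∷ ys) × Linked _≺_ (y ∷ ys)
    below y≺x [-] = y≺x ∷ [] , [-]
    below y≺x (inj₁ (x≺y , _) ∷ l) = contradiction y≺x (≺-asym x≺y)
    below y≺x (inj₂ (inj₂ (_ , x≺y)) ∷ l) = contradiction y≺x (≺-asym x≺y)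
    below y≺x (inj₂ (inj₁ (y≺z , z≺x)) ∷ l) with a , k ← below z≺x l = y≺x ∷ a , y≺z ∷ k

    above : ∀ {x y ys} → x ≺ y → Linked (C x) (y ∷ ys) →
            ∃₂ λ us vs → ys ≡ us ++ vs × Linked _≺_ (y ∷ us) × All (_≺ x) vs × Linked _≺_ vs
    above x≺y [-] = [] , [] , refl , [-] , [] , []
    above x≺y (inj₁ (_ , y≺z) ∷ l) with us , vs , eq , k , a , m ← above (≺-trans x≺y y≺z) l =
      _ ∷ us , vs , cong (_ ∷_) eq , y≺z ∷ k , a , m
    above x≺y (inj₂ (inj₁ (y≺z , z≺x)) ∷ l) = contradiction x≺y (≺-asym (≺-trans y≺z z≺x))
    above x≺y (inj₂ (inj₂ (z≺x , _)) ∷ l) with a , m ← below z≺x l = [] , _ , refl , [-] , a , m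

    append : ∀ {x us vs} → All (_≺ x) vs → Linked _≺_ vs → Linked _≺_ (x ∷ us) → Linked _≺_ (vs ++ x ∷ us)
    append []            []      k = k
    append (v≺x ∷ [])    [-]     k = v≺x ∷ k
    append (v≺x ∷ a)     (r ∷ l) k = r ∷ append a l k

  -- Seen from `x` the list climbs above `x`, then jumps below it at most once and stays below.
  -- Putting the part below in front of `x` sorts everything.
  frame-sorted : ∀ x xs → All (x ≢_) xs → Linked (C x) xs → CycSorted (x ∷ xs)
  frame-sorted x []       _         _ = 0 , [-]
  frame-sorted x (y ∷ ys) (x≢y ∷ _) l with ≺-cmp x y
  ... | tri≈ _ x≡y _ = contradiction x≡y x≢y
  ... | tri> _ _ y≺x with a , k ← below y≺x l = cycSorted⁺ (x ∷ []) (y ∷ ys) (append a k [-])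
  ... | tri< x≺y _ _ with us , vs , refl , k , a , m ← above x≺y l = cycSorted⁺ (x ∷ y ∷ us) vs (append a m (x≺y ∷ k))

  module _ {M : ℕ} (f : ℕ → ℕ) (f≢ : ∀ {p} → 1 ≤ p → p ≤ M → f 0 ≢ f p) where
    open Chains M (λ p q → C? (f 0) (f p) (f q))

    -- The last element is kept apart so that the next step of the chain can be appended to it.
    chain-list : ∀ {m q} → Chain m q → ∃ λ ys → suc (length ys) ≡ m ×
      f 0 ∷ ys ⊆ applyUpTo f q × Linked (C (f 0)) (ys ∷ʳ f q) × All (f 0 ≢_) (ys ∷ʳ f q) × q ≤ M
    chain-list (start {suc p} 1≤p p≤M) = [] , refl , refl ∷ minimum _ , [-] , f≢ 1≤p p≤M ∷ [] , p≤M
    chain-list (extend {p = p} {q} c p<q q≤M r) with ys , len , sub , l , a , p≤M ← chain-list c =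
      ys ∷ʳ f p ,
      cong suc (trans (length-++ ys) (trans (+-comm (length ys) 1) len)) ,
      ⊆-trans (subst (f 0 ∷ ys ∷ʳ f p ⊆_) (applyUpTo-∷ʳ f p) (++⁺ sub ⊆-refl)) (applyUpTo-mono f p<q) ,
      Linked-∷ʳ ys l r , All.∷ʳ⁺ a (f≢ (≤-trans (s≤s z≤n) p<q) q≤M) , q≤M

    chain-sublist : ∀ {m q} → Chain m q → ∃ λ xs → xs ⊆ applyUpTo f (suc M) × length xs ≡ suc m × CycSorted xs
    chain-sublist {q = q} c with ys , len , sub , l , a , q≤M ← chain-list c =
      f 0 ∷ ys ∷ʳ f q ,
      ⊆-trans (subst (f 0 ∷ ys ∷ʳ f q ⊆_) (applyUpTo-∷ʳ f q) (++⁺ sub ⊆-refl)) (applyUpTo-mono f (s≤s q≤M)) ,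
      cong suc (trans (length-++ ys) (trans (+-comm (length ys) 1) len)) ,
      frame-sorted (f 0) (ys ∷ʳ f q) a l

  -- A sublist of a rotated period splits at the wrap-around; exchanging the halves gives a sublist
  -- of the unrotated one.
  rotated-sublist : ∀ (g : ℕ → ℕ) c b → (∀ p → g (c + b + p) ≡ g p) →
    ∀ {xs} → xs ⊆ applyUpTo (λ o → g (o + b)) (c + b) → CycSorted xs →
    ∃ λ ys → ys ⊆ applyUpTo g (c + b) × length ys ≡ length xs × CycSorted ys
  rotated-sublist g c b period {xs} sub sorted = go (⊆-split-++ (applyUpTo f c) (subst (xs ⊆_) (applyUpTo-+ f c b) sub))
    where
    f : ℕ → ℕ
    f o = g (o + b)
    eq : applyUpTo (λ i → f (c + i)) b ++ applyUpTo f c ≡ applyUpTo g (c + b)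
    eq = trans (cong₂ _++_
           (applyUpTo-cong b λ {i} _ → trans (cong g (trans (+-assoc c i b) (trans (cong (c +_) (+-comm i b)) (sym (+-assoc c b i))))) (period i))
           (applyUpTo-cong c λ {i} _ → cong g (+-comm i b)))
         (trans (sym (applyUpTo-+ g b c)) (cong (applyUpTo g) (+-comm b c)))
    go : (∃₂ λ x y → xs ≡ x ++ y × x ⊆ applyUpTo f c × y ⊆ applyUpTo (λ i → f (c + i)) b) →
         ∃ λ ys → ys ⊆ applyUpTo g (c + b) × length ys ≡ length xs × CycSorted ys
    go (x , y , refl , x⊆ , y⊆) = y ++ x , subst (y ++ x ⊆_) eq (++⁺ y⊆ x⊆) ,
      trans (length-++ y) (trans (+-comm (length y) _) (sym (length-++ x))) , cycSorted-swap x y sorted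

-- Extremal cyclic permutations are linear

module Increasing = Cyclic _<_ <-isStrictTotalOrder
module Decreasing = Cyclic _>_ (Flip.isStrictTotalOrder <-isStrictTotalOrder)

C<⇒C> : ∀ {a b c} → Increasing.C a c b → Decreasing.C a b c
C<⇒C> (inj₁ (p , q))        = inj₂ (inj₁ (q , p))
C<⇒C> (inj₂ (inj₁ (p , q))) = inj₁ (q , p)
C<⇒C> (inj₂ (inj₂ (p , q))) = inj₂ (inj₂ (q , p))

Chain-map : ∀ {M} {R S : ℕ → ℕ → Set} {R? : ∀ p q → Dec (R p q)} {S? : ∀ p q → Dec (S p q)} →
  (∀ {p q} → R p q → S p q) → ∀ {m q} → Chains.Chain M R? m q → Chains.Chain M S? m q
Chain-map h (Chains.start a b)      = Chains.start a b
Chain-map h (Chains.extend c a b r) = Chains.extend (Chain-map h c) a b (h r)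

module Uniqueness (K L : ℕ) (1≤K : 1 ≤ K) (1≤L : 1 ≤ L) (g : ℕ → ℕ)
  (g-% : ∀ p → g (p % suc (K * L)) ≡ g p)
  (g-injective : ∀ {p q} → p < suc (K * L) → q < suc (K * L) → g p ≡ g q → p ≡ q)
  (g-0 : g 0 ≡ 1)
  (g-onto : ∀ {v} → 1 ≤ v → v ≤ suc (K * L) → ∃ λ p → g p ≡ v)
  (¬inc : ∀ {xs} → xs ⊆ applyUpTo g (suc (K * L)) → length xs ≡ suc (suc K) → ¬ Increasing.CycSorted xs)
  (¬dec : ∀ {xs} → xs ⊆ applyUpTo g (suc (K * L)) → length xs ≡ suc (suc L) → ¬ Decreasing.CycSorted xs)
  where

  M N : ℕ
  M = K * L
  N = suc M

  g-cong : ∀ {p q} → p % N ≡ q % N → g p ≡ g q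
  g-cong {p} {q} eq = trans (sym (g-% p)) (trans (cong g eq) (g-% q))

  g-shift : ∀ m p → g (m * N + p) ≡ g p
  g-shift m p = g-cong {m * N + p} {p} (trans (cong (_% N) (+-comm (m * N) p)) ([m+kn]%n≡m%n p m N))

  g-distinct : ∀ b {p q} → p < q → q ≤ M → g (p + b) ≢ g (q + b)
  g-distinct b {p} {q} p<q q≤M eq = %-≢ N (p + b) {q ∸ p} (m<n⇒0<n∸m p<q) (s≤s (≤-trans (m∸n≤m q p) q≤M))
    (trans (g-injective (m%n<n (p + b) N) (m%n<n (q + b) N) (trans (g-% (p + b)) (trans eq (sym (g-% (q + b))))))
      (cong (_% N) eq′))
    where
    eq′ : q + b ≡ p + b + (q ∸ p)
    eq′ = trans (cong (_+ b) (sym (m+[n∸m]≡n (<⇒≤ p<q))))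
      (solve 3 (λ p b d → p :+ d :+ b := p :+ b :+ d) refl p b (q ∸ p))
      where open +-*-Solver

  offsets : ∀ b (P : ℕ → Set) → (∀ {x} → x ≤ M → P (g (x + b))) → ∀ z → P (g z)
  offsets b P h z = subst P (g-cong {x + b} {z} eq) (h (≤-pred (m%n<n (z + b * M) N)))
    where
    x : ℕ
    -- Modulo N = M + 1, `b * M` is -b.
    x = (z + b * M) % N
    open +-*-Solver
    eq : (x + b) % N ≡ z % N
    eq = begin
      (x + b) % N                   ≡⟨ %-distribˡ-+ x b N ⟩
      (x % N + b % N) % N           ≡⟨ cong (λ y → (y + b % N) % N) (m%n%n≡m%n (z + b * M) N) ⟩
      (x + b % N) % N               ≡⟨ sym (%-distribˡ-+ (z + b * M) b N) ⟩
      (z + b * M + b) % N           ≡⟨ cong (_% N) (solve 3 (λ z b m → z :+ b :* m :+ b := z :+ b :* (con 1 :+ m)) refl z b M) ⟩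
      (z + b * N) % N               ≡⟨ [m+kn]%n≡m%n z b N ⟩
      z % N                         ∎
      where open ≡-Reasoning

  N≡ : ∀ b → N ∸ b % N + b % N ≡ N
  N≡ b = m∸n+n≡m (<⇒≤ (m%n<n b N))

  unrotate : ∀ b {xs} → xs ⊆ applyUpTo (λ o → g (o + b)) N → xs ⊆ applyUpTo (λ o → g (o + b % N)) (N ∸ b % N + b % N)
  unrotate b {xs} = subst (xs ⊆_) (trans
    (applyUpTo-cong N λ {o} _ → g-cong {o + b} {o + b % N} (trans (%-distribˡ-+ o b N)
      (trans (cong (λ y → (o % N + y) % N) (sym (m%n%n≡m%n b N))) (sym (%-distribˡ-+ o (b % N) N)))))
    (cong (applyUpTo _) (sym (N≡ b))))

  period : ∀ b p → g (N ∸ b % N + b % N + p) ≡ g p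
  period b p = trans (cong (λ n → g (n + p)) (trans (N≡ b) (sym (+-identityʳ N)))) (g-shift 1 p)

  Q : ℕ → ℕ → ℕ → Set
  Q x y z = Increasing.C (g x) (g y) (g z)

  Q? : ∀ b p q → Dec (Q b (p + b) (q + b))
  Q? b p q = Increasing.C? (g b) (g (p + b)) (g (q + b))

  no-inc-chain : ∀ b {q} → ¬ Chains.Chain M (Q? b) (suc K) q
  no-inc-chain b c
    with xs , sub , len , sorted ← Increasing.chain-sublist (λ o → g (o + b)) (λ 1≤p p≤M → g-distinct b 1≤p p≤M) c
    with ys , sub′ , len′ , sorted′ ← Increasing.rotated-sublist g (N ∸ b % N) (b % N) (period b) (unrotate b sub) sorted
    = ¬inc (subst (λ n → ys ⊆ applyUpTo g n) (N≡ b) sub′) (trans len′ len) sorted′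

  no-dec-chain : ∀ b {q} → ¬ Chains.Chain M (flip (Q? b)) (suc L) q
  no-dec-chain b c
    with xs , sub , len , sorted ← Decreasing.chain-sublist (λ o → g (o + b)) (λ 1≤p p≤M → g-distinct b 1≤p p≤M) (Chain-map C<⇒C> c)
    with ys , sub′ , len′ , sorted′ ← Decreasing.rotated-sublist g (N ∸ b % N) (b % N) (period b) (unrotate b sub) sorted
    = ¬dec (subst (λ n → ys ⊆ applyUpTo g n) (N≡ b) sub′) (trans len′ len) sorted′

  labelling : ∀ b → Labelling M K L (λ p q → Q b (p + b) (q + b))
  labelling b = erdős-szekeres-labelling (Q? b)
    (λ 1≤p p<q q≤M → Increasing.C-total (g-distinct b 1≤p (≤-trans (<⇒≤ p<q) q≤M)) (g-distinct b (≤-trans (s≤s z≤n) p<q) q≤M) (g-distinct b p<q q≤M))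
    (no-inc-chain b) (no-dec-chain b)

  unshift : ∀ m {a b c} → Q (m * N + a) (m * N + b) (m * N + c) → Q a b c
  unshift m {a} {b} {c} = subst₂ (λ x y → Increasing.C x y (g (m * N + c)) → Q a b c) (sym (g-shift m a)) (sym (g-shift m b))
    (subst (Increasing.C (g a) (g b)) (g-shift m c))

  -- No value lies strictly between that of b and that of c + b.
  Next : ℕ → Set
  Next c = ∀ b z → ¬ Increasing.C (g b) (g z) (g (c + b))

  next-offsets : ∀ {c} → (∀ b {x} → 1 ≤ x → x ≤ M → ¬ Q b (x + b) (c + b)) → Next c
  next-offsets {c} h b = offsets b (λ v → ¬ Increasing.C (g b) v (g (c + b)))
    λ { {zero} _ → Increasing.C-irrefl ; {suc x} x≤M → h b (s≤s z≤n) x≤M }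

  next-exists : Next (suc (pred L * K)) ⊎ Next L
  next-exists with m≤n⇒m<n∨m≡n 1≤K | m≤n⇒m<n∨m≡n 1≤L
  -- For K = 1 all `U` equal 1: from any base the values decrease, and the last offset M = L carries
  -- the successor.
  ... | inj₂ refl | _ = inj₂ (next-offsets λ b {x} 1≤x x≤M q → case₁ b 1≤x (subst (x ≤_) (+-identityʳ L) x≤M) q)
    where
    case₁ : ∀ b {x} → 1 ≤ x → x ≤ L → ¬ Q b (x + b) (L + b)
    case₁ b {x} 1≤x x≤L q with m≤n⇒m<n∨m≡n x≤L
    ... | inj₂ refl = Increasing.C-asym q q
    ... | inj₁ x<L  = <⇒≱ (U-mono 1≤x x<L L≤M q) (≤-trans (U≤K 1≤L L≤M) (1≤U 1≤x (≤-trans x≤L L≤M)))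
      where
      open Labelling (labelling b)
      L≤M : L ≤ M
      L≤M = ≤-reflexive (sym (+-identityʳ L))
  -- For L = 1 all `V` equal 1: the values increase, and the offset N - K is 1.
  ... | inj₁ _ | inj₂ refl = inj₁ (next-offsets case₂)
    where
    case₂ : ∀ b {x} → 1 ≤ x → x ≤ M → ¬ Q b (x + b) (1 + b)
    case₂ b {x} 1≤x x≤M q with m≤n⇒m<n∨m≡n 1≤x
    ... | inj₂ refl = Increasing.C-asym q q
    ... | inj₁ 1<x  = <⇒≱ (V-mono ≤-refl 1<x x≤M q) (≤-trans (V≤L 1≤x x≤M) (1≤V ≤-refl (≤-trans 1≤x x≤M)))
      where open Labelling (labelling b)
  ... | inj₁ 2≤K | inj₁ 2≤L with Labelling.total (labelling 0) {1} {2} ≤-refl ≤-refl (≤-trans 2≤K (m≤m*n K L {{>-nonZero 1≤L}}))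
  ...   | inj₁ q = inj₁ (next-offsets (CyclicLabels.next-value M K L refl Q Increasing.C-rot Increasing.C-asym Increasing.C-trans unshift labelling 2≤K 2≤L q))
  -- In the reversed order the offset c′ = N - L carries the predecessor, so stepping by L reaches
  -- the successor.
  ...   | inj₂ q = inj₂ next-L
    where
    c′ : ℕ
    c′ = suc (pred K * L)
    prev : ∀ b z → ¬ Increasing.C (g b) (g (c′ + b)) (g z)
    prev b = offsets b (λ v → ¬ Increasing.C (g b) (g (c′ + b)) v)
      λ { {zero} _ r → Increasing.C-irrefl (Increasing.C-rot (Increasing.C-rot r))
        ; {suc x} x≤M → CyclicLabels.next-value M L K (*-comm K L) (λ x y z → Q x z y)
            (λ r → Increasing.C-rot (Increasing.C-rot r)) Increasing.C-asym (λ r s → Increasing.C-trans s r) (λ m → unshift m)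
            (λ b → Labelling-flip (labelling b)) 2≤L 2≤K q b (s≤s z≤n) x≤M }
    wrap : ∀ b → g (c′ + (L + b)) ≡ g b
    wrap b = trans (cong g eq) (g-shift 1 b)
      where
      eq : c′ + (L + b) ≡ 1 * N + b
      eq = cong suc (begin
        pred K * L + (L + b)   ≡⟨ sym (+-assoc (pred K * L) L b) ⟩
        pred K * L + L + b     ≡⟨ cong (_+ b) (+-comm (pred K * L) L) ⟩
        suc (pred K) * L + b   ≡⟨ cong (λ k → k * L + b) (suc-pred K {{>-nonZero 1≤K}}) ⟩
        M + b                  ≡⟨ cong (_+ b) (sym (+-identityʳ M)) ⟩
        M + 0 + b              ∎)
        where open ≡-Reasoning
    next-L : Next L
    next-L b z r = prev (L + b) z (subst (λ v → Increasing.C (g (L + b)) v (g z)) (sym (wrap b)) (Increasing.C-rot (Increasing.C-rot r)))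

  -- The value g b + 1 is attained somewhere; were it not at c + b, it would lie strictly between
  -- the two values.
  next-value-suc : ∀ {c} → 1 ≤ c → c ≤ M → Next c → ∀ b → g b < N → g (c + b) ≡ suc (g b)
  next-value-suc {c} 1≤c c≤M next b gb<N with p , gp ← g-onto {suc (g b)} (s≤s z≤n) gb<N
    with <-cmp (suc (g b)) (g (c + b))
  ... | tri≈ _ eq _ = sym eq
  ... | tri< lt _ _ = contradiction (subst (λ v → Increasing.C (g b) v (g (c + b))) (sym gp) (inj₁ (≤-refl , lt))) (next b p)
  ... | tri> _ _ gt = contradiction (subst (λ v → Increasing.C (g b) v (g (c + b))) (sym gp)
          (inj₂ (inj₂ (≤∧≢⇒< (≤-pred gt) (λ eq → g-distinct b 1≤c c≤M (sym eq)) , ≤-refl)))) (next b p)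

  values : ∀ {c} → 1 ≤ c → c ≤ M → Next c → ∀ q → q < N → g (q * c) ≡ suc q
  values 1≤c c≤M next zero    q<N = g-0
  values {c} 1≤c c≤M next (suc q) q<N with eq ← values 1≤c c≤M next q (<⇒≤ q<N) =
    trans (next-value-suc 1≤c c≤M next (q * c) (subst (_< N) (sym eq) q<N)) (cong suc eq)

  -- Value q + 1 sits at position q c, and modulo `N` the position p is q c for q = d p.
  linear : ∀ {c} d t → c * d ≡ 1 + t * N → 1 ≤ c → c ≤ M → Next c → ∀ p → g p ≡ suc (d * p % N)
  linear {c} d t cd≡1 1≤c c≤M next p =
    trans (g-cong {p} {d * p % N * c} (sym (*-%-inverse N c d t cd≡1 p))) (values 1≤c c≤M next (d * p % N) (m%n<n (d * p) N))

-- Linear cyclic permutations are extremal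

-- The weight w = (α p + β x) / N rises by at least 1 along every step of a
-- cyclic sequence, except that it may drop by less than α where the positions
-- wrap around and by less than β where the values do.
module Weight (N : ℕ) .{{_ : NonZero N}} (α β : ℕ) (1≤α : 1 ≤ α) (1≤β : 1 ≤ β) (x w : ℕ → ℕ)
  (weight : ∀ p → α * p + β * x p ≡ w p * N)
  (x-close : ∀ p q → x p < x q + N)
  where

  private instance
    α≢0 : NonZero α
    α≢0 = >-nonZero 1≤α
    β≢0 : NonZero β
    β≢0 = >-nonZero 1≤β

  w-< : ∀ {p q d} → α * p + β * x p < α * q + β * x q + d * N → w p < w q + d
  w-< {p} {q} {d} lt = *-cancelʳ-< N (w p) (w q + d) (begin-strict
    w p * N                     ≡⟨ sym (weight p) ⟩
    α * p + β * x p             <⟨ lt ⟩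
    α * q + β * x q + d * N     ≡⟨ cong (_+ d * N) (weight q) ⟩
    w q * N + d * N             ≡⟨ sym (*-distribʳ-+ N (w q) d) ⟩
    (w q + d) * N               ∎)
    where open ≤-Reasoning

  rise : ∀ {p q} → p < q → x p < x q → w p < w q
  rise {p} {q} p<q xp<xq = subst (w p <_) (+-identityʳ (w q)) (w-<
    (subst (α * p + β * x p <_) (sym (+-identityʳ _)) (+-mono-< (*-monoʳ-< α p<q) (*-monoʳ-< β xp<xq))))

  wrap-position : ∀ {p q} → p < N → x p < x q → w p < w q + α
  wrap-position {p} {q} p<N xp<xq = w-< (begin-strict
    α * p + β * x p             <⟨ +-mono-< (*-monoʳ-< α (≤-trans p<N (m≤n+m N q))) (*-monoʳ-< β xp<xq) ⟩
    α * (q + N) + β * x q       ≡⟨ solve 4 (λ α q N b → α :* (q :+ N) :+ b := α :* q :+ b :+ α :* N) refl α q N (β * x q) ⟩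
    α * q + β * x q + α * N     ∎)
    where
    open ≤-Reasoning
    open +-*-Solver

  wrap-value : ∀ {p q} → p < q → w p < w q + β
  wrap-value {p} {q} p<q = w-< (begin-strict
    α * p + β * x p             <⟨ +-mono-< (*-monoʳ-< α p<q) (*-monoʳ-< β (x-close p q)) ⟩
    α * q + β * (x q + N)       ≡⟨ solve 4 (λ a β x N → a :+ β :* (x :+ N) := a :+ β :* x :+ β :* N) refl (α * q) β (x q) N ⟩
    α * q + β * x q + β * N     ∎)
    where
    open ≤-Reasoning
    open +-*-Solver

  spread : ∀ {p q} → p < N → w p < w q + (α + β)
  spread {p} {q} p<N = w-< (begin-strict
    α * p + β * x p                 <⟨ +-mono-< (*-monoʳ-< α (≤-trans p<N (m≤n+m N q))) (*-monoʳ-< β (x-close p q)) ⟩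
    α * (q + N) + β * (x q + N)     ≡⟨ solve 5 (λ α q N β x → α :* (q :+ N) :+ β :* (x :+ N) := α :* q :+ β :* x :+ (α :+ β) :* N) refl α q N β (x q) ⟩
    α * q + β * x q + (α + β) * N   ∎)
    where
    open ≤-Reasoning
    open +-*-Solver

  Rise : ℕ → ℕ → Set
  Rise p q = x p < x q

  climb : ∀ {p ps} → Linked _<_ (p ∷ ps) → Linked Rise (p ∷ ps) → w p + length ps ≤ w (last′ p ps)
  climb {p} {[]} _ _ = ≤-reflexive (+-identityʳ (w p))
  climb {p} {q ∷ ps} (p<q ∷ l) (r ∷ k) = begin
    w p + suc (length ps) ≡⟨ +-suc (w p) (length ps) ⟩
    suc (w p) + length ps ≤⟨ +-monoˡ-≤ (length ps) (rise p<q r) ⟩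
    w q + length ps       ≤⟨ climb l k ⟩
    w (last′ q ps)        ∎
    where open ≤-Reasoning

  linear-bound : ∀ ps → All (_< N) ps → Linked _<_ ps → Linked Rise ps → length ps ≤ α + β
  linear-bound [] _ _ _ = z≤n
  linear-bound (p ∷ ps) bs l k = +-cancelˡ-≤ (w p) _ _ (begin
    w p + suc (length ps) ≡⟨ +-suc (w p) (length ps) ⟩
    suc (w p + length ps) ≤⟨ s≤s (climb l k) ⟩
    suc (w (last′ p ps))  ≤⟨ spread (All-last bs) ⟩
    w p + (α + β)         ∎)
    where open ≤-Reasoning

  -- Both pieces climb. From the end of `u` to the head of `v` only values can wrap, and from the
  -- end of `v` to the head of `u` only positions do; the drops are below β and α, and adding up
  -- around the circle bounds the length.
  cyclic-bound : ∀ u v → All (_< N) (u ++ v) → Linked _<_ (u ++ v) → Linked Rise (v ++ u) → length (u ++ v) ≤ α + β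
  cyclic-bound [] v bs l k = linear-bound v bs l (subst (Linked Rise) (++-identityʳ v) k)
  cyclic-bound u@(_ ∷ _) [] bs l k = linear-bound (u ++ []) bs l (subst (Linked Rise) (sym (++-identityʳ u)) k)
  cyclic-bound (a ∷ as) (c ∷ cs) bs l k
    with la , a<c , lc ← Linked-++⁻ a as l | kc , c≺a , ka ← Linked-++⁻ c cs k
    = subst (_≤ α + β) (sym (length-++ (a ∷ as))) (+-cancelˡ-≤ (w a + w c) _ _ (begin
      w a + w c + (suc m + suc n)                ≡⟨ solve 4 (λ wa wc m n → wa :+ wc :+ (con 1 :+ m :+ (con 1 :+ n)) := con 1 :+ (wa :+ m) :+ (con 1 :+ (wc :+ n))) refl (w a) (w c) m n ⟩
      suc (w a + m) + suc (w c + n)              ≤⟨ +-mono-≤ (s≤s (climb la ka)) (s≤s (climb lc kc)) ⟩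
      suc (w (last′ a as)) + suc (w (last′ c cs)) ≤⟨ +-mono-≤ (wrap-value a<c) (wrap-position (All-last (All.++⁻ʳ (a ∷ as) bs)) c≺a) ⟩
      (w c + β) + (w a + α)                      ≡⟨ solve 4 (λ wa wc α β → wc :+ β :+ (wa :+ α) := wa :+ wc :+ (α :+ β)) refl (w a) (w c) α β ⟩
      w a + w c + (α + β)                        ∎))
    where
    open ≤-Reasoning
    open +-*-Solver
    m n : ℕ
    m = length as
    n = length cs

  sublist-bound : ∀ {_≺_ : ℕ → ℕ → Set} (f : ℕ → ℕ) → (∀ {p q} → f p ≺ f q → x p < x q) →
    ∀ {xs} → xs ⊆ applyUpTo f N → ∀ i → Linked _≺_ (rotate i xs) → length xs ≤ α + β
  sublist-bound {_≺_} f f⇒x {xs} sub i l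
    with ps , ps⊆ , refl ← ⊆-map⁻ f (upTo N) (subst (xs ⊆_) (sym (map-upTo f N)) sub)
    = subst (_≤ α + β) (trans (cong length (take++drop≡id i ps)) (sym (length-map f ps)))
        (cyclic-bound (take i ps) (drop i ps)
          (subst (All (_< N)) (sym (take++drop≡id i ps)) (All-resp-⊆ ps⊆ (All.applyUpTo⁺₁ id N id)))
          (subst (Linked _<_) (sym (take++drop≡id i ps))
            (Linked.AllPairs⇒Linked (AllPairs-resp-⊆ ps⊆ (AllPairs.applyUpTo⁺₁ id N (λ i<j _ → i<j)))))
          (Linked.map f⇒x (Linked.map⁻ (subst (Linked _≺_)
            (trans (cong₂ _++_ (drop-map i ps) (take-map i ps)) (sym (map-++ f (drop i ps) (take i ps)))) l))))

-- The two linear cyclic permutations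

module Linear (K′ L′ : ℕ) where

  K L N E : ℕ
  K = suc K′
  L = suc L′
  N = suc (K * L)
  E = suc (L′ * K)

  line : ℕ → ℕ → ℕ
  line d p = suc (d * p % N)

  tail : ℕ → List ℕ
  tail d = applyUpTo (λ p → line d (suc p)) (K * L)

  ∷-tail : ∀ d → 1 ∷ tail d ≡ applyUpTo (line d) N
  ∷-tail d = cong (_∷ tail d) (cong suc (sym (cong (_% N) (*-zeroʳ d))))

  size≡N : size (suc K) (suc L) ≡ N
  size≡N = +-comm (K * L) 1

  -- `E` is N - K, and it is the inverse of `L` modulo `N`: the slope of either permutation is the
  -- successor offset of the other.
  EL≡1 : E * L ≡ 1 + L′ * N
  EL≡1 = solve 2 (λ k l → (con 1 :+ l :* (con 1 :+ k)) :* (con 1 :+ l) :=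
                          con 1 :+ l :* (con 1 :+ (con 1 :+ k) :* (con 1 :+ l))) refl K′ L′
    where open +-*-Solver

  LE≡1 : L * E ≡ 1 + L′ * N
  LE≡1 = trans (*-comm L E) EL≡1

  E≤M : E ≤ K * L
  E≤M = ≤-trans (+-monoˡ-≤ (L′ * K) {1} {K} (s≤s z≤n)) (≤-reflexive (*-comm L K))

  L≤M : L ≤ K * L
  L≤M = m≤n*m L K

  tail-isCycPerm : ∀ c d t → c * d ≡ 1 + t * N → IsCycPerm (size (suc K) (suc L)) (tail d)
  tail-isCycPerm c d t cd≡1 = subst₂ (λ s n → s ↭ [1‥ n ]) (sym (∷-tail d)) (sym size≡N)
    (unique-⊆⇒↭ (Unique.applyUpTo⁺₁ (line d) N distinct) sub
      (trans (length-applyUpTo (line d) N) (sym (length-[1‥] N))))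
    where
    distinct : ∀ {i j} → i < j → j < N → line d i ≢ line d j
    distinct {i} {j} i<j j<N eq = <⇒≢ i<j (begin
      i                        ≡⟨ sym (m<n⇒m%n≡m (<-trans i<j j<N)) ⟩
      i % N                    ≡⟨ sym (*-%-inverse N c d t cd≡1 i) ⟩
      (d * i % N * c) % N      ≡⟨ cong (λ z → (z * c) % N) (suc-injective eq) ⟩
      (d * j % N * c) % N      ≡⟨ *-%-inverse N c d t cd≡1 j ⟩
      j % N                    ≡⟨ m<n⇒m%n≡m j<N ⟩
      j                        ∎)
      where open ≡-Reasoning
    sub : ∀ {v} → v ∈ applyUpTo (line d) N → v ∈ [1‥ N ]
    sub v∈ with i , _ , refl ← ∈-applyUpTo⁻ (line d) v∈ =
      subst (line d i ∈_) (sym (map-upTo suc N)) (∈-applyUpTo⁺ suc (m%n<n (d * i) N))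

  no-inc-sub : ∀ α β d → 1 ≤ α → 1 ≤ β → α + β ≡ suc K → (∀ p → N ∣ α * p + β * (d * p % N)) →
               ¬ HasIncSub (suc (suc K)) (1 ∷ tail d)
  no-inc-sub α β d 1≤α 1≤β sum dvd (xs , sub , len , i , l) =
    1+n≰n (subst₂ _≤_ len sum (W.sublist-bound (line d) ≤-pred (subst (xs ⊆_) (∷-tail d) sub) i l))
    where
    module W = Weight N α β 1≤α 1≤β (λ p → d * p % N) (λ p → quotient (dvd p)) (λ p → _∣_.equality (dvd p))
      (λ p q → ≤-trans (m%n<n (d * p) N) (m≤n+m N _))

  -- Complementing the values in `N` turns decreasing sequences into increasing ones.
  no-dec-sub : ∀ α β d → 1 ≤ α → 1 ≤ β → α + β ≡ suc L → (∀ p → N ∣ α * p + β * (N ∸ d * p % N)) →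
               ¬ HasDecSub (suc (suc L)) (1 ∷ tail d)
  no-dec-sub α β d 1≤α 1≤β sum dvd (xs , sub , len , i , l) =
    1+n≰n (subst₂ _≤_ len sum (W.sublist-bound (line d)
      (λ {p} {q} gt → ∸-monoʳ-< (≤-pred gt) (<⇒≤ (m%n<n (d * p) N))) (subst (xs ⊆_) (∷-tail d) sub) i l))
    where
    module W = Weight N α β 1≤α 1≤β (λ p → N ∸ d * p % N) (λ p → quotient (dvd p)) (λ p → _∣_.equality (dvd p))
      (λ p q → ≤-trans (s≤s (m∸n≤m N (d * p % N))) (+-monoˡ-≤ N (m<n⇒0<n∸m (m%n<n (d * q) N))))

  -- The weights are p + K (L p) = p N for increasing and L p - L p ≡ 0 for decreasing sequences.
  tail-L-∈C : InC (suc K) (suc L) (tail L)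
  tail-L-∈C = tail-isCycPerm E L L′ EL≡1 ,
    no-inc-sub 1 K L ≤-refl (s≤s z≤n) refl
      (λ p → ∣+*% N (1 * p) K (L * p) p
        (solve 3 (λ p k l → con 1 :* p :+ k :* (l :* p) := p :* (con 1 :+ k :* l)) refl p K L)) ,
    no-dec-sub L 1 L (s≤s z≤n) ≤-refl (+-comm L 1)
      (λ p → ∣+*[N∸%] N (L * p) 1 (L * p) 0
        (solve 1 (λ a → a :+ con 0 := con 1 :* a) refl (L * p)))
    where open +-*-Solver

  -- Here K p + E p = p N, and p - L E p ≡ 0 because L E ≡ 1.
  tail-E-∈C : InC (suc K) (suc L) (tail E)
  tail-E-∈C = tail-isCycPerm L E L′ LE≡1 ,
    no-inc-sub K 1 E (s≤s z≤n) ≤-refl (+-comm K 1)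
      (λ p → ∣+*% N (K * p) 1 (E * p) p
        (solve 3 (λ p k l → k :* p :+ con 1 :* ((con 1 :+ l :* k) :* p) := p :* (con 1 :+ k :* (con 1 :+ l))) refl p K L′)) ,
    no-dec-sub 1 L E ≤-refl (s≤s z≤n) refl
      (λ p → ∣+*[N∸%] N (1 * p) L (E * p) (L′ * p) (begin
        1 * p + L′ * p * N  ≡⟨ solve 3 (λ p l n → con 1 :* p :+ l :* p :* n := (con 1 :+ l :* n) :* p) refl p L′ N ⟩
        (1 + L′ * N) * p    ≡⟨ cong (_* p) (sym LE≡1) ⟩
        L * E * p           ≡⟨ *-assoc L E p ⟩
        L * (E * p)         ∎))
    where
    open +-*-Solver
    open ≡-Reasoning

  ∈C⇒tail : ∀ {as} → InC (suc K) (suc L) as → as ≡ tail L ⊎ as ≡ tail E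
  -- Successor offset E means slope L, and conversely.
  ∈C⇒tail {as} (perm , ¬inc , ¬dec) = [ (λ next → inj₁ (conclude L (linear L L′ EL≡1 (s≤s z≤n) E≤M next)))
                                      , (λ next → inj₂ (conclude E (linear E L′ LE≡1 (s≤s z≤n) L≤M next))) ]′ next-exists
    where
    s : List ℕ
    s = 1 ∷ as
    s↭ : s ↭ [1‥ N ]
    s↭ = subst (λ n → s ↭ [1‥ n ]) size≡N perm
    length-s : length s ≡ N
    length-s = trans (↭-length s↭) (length-[1‥] N)
    s≡ : applyUpTo (entry s) N ≡ s
    s≡ = subst (λ n → applyUpTo (entry s) n ≡ s) length-s (applyUpTo-entry s)
    g : ℕ → ℕ
    g p = entry s (p % N)
    g≡s : applyUpTo g N ≡ s
    g≡s = trans (applyUpTo-cong N λ i<N → cong (entry s) (m<n⇒m%n≡m i<N)) s≡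
    unique-s : Unique s
    unique-s = Permutationₛ.Unique-resp-↭ (setoid ℕ) (↭⇒↭ₛ (↭-sym s↭))
      (Unique.map⁺ suc-injective (Unique.upTo⁺ N))
    g-distinct : ∀ {p q} → p < q → q < N → g p ≢ g q
    g-distinct = AllPairs-applyUpTo⁻ g N (subst Unique (sym g≡s) unique-s)
    g-injective : ∀ {p q} → p < N → q < N → g p ≡ g q → p ≡ q
    g-injective {p} {q} p<N q<N eq with <-cmp p q
    ... | tri< p<q _ _ = contradiction eq (g-distinct p<q q<N)
    ... | tri≈ _ p≡q _ = p≡q
    ... | tri> _ _ q<p = contradiction (sym eq) (g-distinct q<p p<N)
    g-onto : ∀ {v} → 1 ≤ v → v ≤ N → ∃ λ p → g p ≡ v
    g-onto {suc v} _ v<N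
      with p , _ , eq ← ∈-applyUpTo⁻ g (subst (suc v ∈_) (sym g≡s)
             (∈-resp-↭ (↭-sym s↭) (subst (suc v ∈_) (sym (map-upTo suc N)) (∈-applyUpTo⁺ suc v<N))))
      = p , sym eq
    open Uniqueness K L (s≤s z≤n) (s≤s z≤n) g (λ p → cong (entry s) (m%n%n≡m%n p N)) g-injective refl g-onto
      (λ {xs} sub len sorted → ¬inc (xs , subst (xs ⊆_) g≡s sub , len , sorted))
      (λ {xs} sub len sorted → ¬dec (xs , subst (xs ⊆_) g≡s sub , len , sorted))
      using (linear; next-exists)
    conclude : ∀ d → (∀ p → g p ≡ line d p) → as ≡ tail d
    conclude d eq = ∷-injectiveʳ (trans (sym g≡s) (trans (applyUpTo-cong N λ {p} _ → eq p) (sym (∷-tail d))))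

  classification : ∀ as → InC (suc K) (suc L) as ⇔ (as ≡ tail L ⊎ as ≡ tail E)
  classification as = mk⇔ ∈C⇒tail λ { (inj₁ refl) → tail-L-∈C ; (inj₂ refl) → tail-E-∈C }

  at-tail : ∀ d m → m < K * L → at (tail d) (suc m) ≡ just (line d (suc m))
  at-tail d m m<M = nth-applyUpTo (λ p → line d (suc p)) m<M

  -- The first entries already differ: they are L + 1 and E + 1.
  tails-distinct : 1 ≤ K′ → 1 ≤ L′ → tail L ≢ tail E
  tails-distinct 1≤K′ 1≤L′ eq = <⇒≢ L<E (begin
    L           ≡⟨ sym (value L L≤M) ⟩
    L * 1 % N   ≡⟨ suc-injective (just-injective (trans (sym (at-tail L 0 (s≤s z≤n)))
                     (trans (cong (λ as → at as 1) eq) (at-tail E 0 (s≤s z≤n))))) ⟩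
    E * 1 % N   ≡⟨ value E E≤M ⟩
    E           ∎)
    where
    open ≡-Reasoning
    L<E : L < E
    L<E = s≤s (m<m*n L′ K {{>-nonZero 1≤L′}} (s≤s 1≤K′))
    value : ∀ d → d ≤ K * L → d * 1 % N ≡ d
    value d d≤M = trans (cong (_% N) (*-identityʳ d)) (m<n⇒m%n≡m (s≤s d≤M))

  -- Explicit formulas for the entries

  index< : ∀ {i j m n} → i < m → j < n → j * m + i < n * m
  index< {i} {j} {m} {n} i<m j<n = begin-strict
    j * m + i   <⟨ +-monoʳ-< (j * m) i<m ⟩
    j * m + m   ≡⟨ +-comm (j * m) m ⟩
    suc j * m   ≤⟨ *-monoˡ-≤ m j<n ⟩
    n * m       ∎
    where open ≤-Reasoning

  tail-condI : CondI (suc K) (suc L) (tail E)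
  tail-condI (suc i) (suc j) _ i<L _ j<K = begin
    at (tail E) (j * L + suc i)             ≡⟨ cong (at (tail E)) (+-suc (j * L) i) ⟩
    at (tail E) (suc (j * L + i))           ≡⟨ at-tail E (j * L + i) (index< i<L j<K) ⟩
    -- For position m, E m ≡ -K m, and adding (j + 1) N brings -K m into the range below `N`.
    just (line E (suc (j * L + i)))         ≡⟨ cong (λ v → just (suc v)) (%-unique N (E * suc (j * L + i)) (suc j) (suc (j * L + i)) y<N eq) ⟩
    just (suc (r * K + suc j))              ≡⟨ cong just (+-comm 1 (r * K + suc j)) ⟩
    just (r * K + suc j + 1)                ∎
    where
    open ≡-Reasoning
    r : ℕ
    r = L ∸ suc i
    L′≡ : L′ ≡ i + r
    L′≡ = sym (m+[n∸m]≡n (≤-pred i<L))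
    y<N : r * K + suc j < N
    y<N = s≤s (≤-trans (+-mono-≤ (*-monoˡ-≤ K (m∸n≤m L′ i)) j<K) (≤-reflexive (trans (+-comm (L′ * K) K) (*-comm L K))))
    eq : E * suc (j * L + i) + suc j * N ≡ r * K + suc j + suc (j * L + i) * N
    -- Writing `L′` as i + r removes truncated subtraction and leaves a polynomial identity.
    eq = subst (λ l → suc (l * K) * suc (j * suc l + i) + suc j * suc (K * suc l) ≡ r * K + suc j + suc (j * suc l + i) * suc (K * suc l)) (sym L′≡)
      (solve 4 (λ k i r j → let l = i :+ r ; n = con 1 :+ k :* (con 1 :+ l) ; m = con 1 :+ (j :* (con 1 :+ l) :+ i) in
        (con 1 :+ l :* k) :* m :+ (con 1 :+ j) :* n := r :* k :+ (con 1 :+ j) :+ m :* n) refl K i r j)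
      where open +-*-Solver

  tail-condII : CondII (suc K) (suc L) (tail L)
  tail-condII (suc i) (suc j) _ i<L _ j<K = begin
    at (tail L) (i * K + suc j)             ≡⟨ cong (at (tail L)) (+-suc (i * K) j) ⟩
    at (tail L) (suc (i * K + j))           ≡⟨ at-tail L (i * K + j) (subst (i * K + j <_) (*-comm L K) (index< j<K i<L)) ⟩
    -- For position m = i K + j + 1, L m exceeds the claimed residue by exactly i N.
    just (line L (suc (i * K + j)))         ≡⟨ cong (λ v → just (suc v)) (%-unique N (L * suc (i * K + j)) 0 i y<N eq) ⟩
    just (suc (j * L + (L ∸ i)))            ≡⟨ cong just (+-comm 1 (j * L + (L ∸ i))) ⟩
    just (j * L + (L ∸ i) + 1)              ∎
    where
    open ≡-Reasoning
    r : ℕ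
    r = L ∸ i
    L≡ : L ≡ i + r
    L≡ = sym (m+[n∸m]≡n (<⇒≤ i<L))
    y<N : j * L + r < N
    y<N = s≤s (≤-trans (+-monoʳ-≤ (j * L) (m∸n≤m L i)) (≤-trans (≤-reflexive (+-comm (j * L) L)) (*-monoˡ-≤ L j<K)))
    eq : L * suc (i * K + j) + 0 * N ≡ j * L + r + i * N
    eq = subst (λ l → l * suc (i * K + j) + 0 ≡ j * l + r + i * suc (K * l)) (sym L≡)
      (solve 4 (λ k i r j → let l = i :+ r in
        l :* (con 1 :+ (i :* k :+ j)) :+ con 0 := j :* l :+ r :+ i :* (con 1 :+ k :* l)) refl K i r j)
      where open +-*-Solver

  -- Division with remainder by `L` shows that the formula prescribes every entry.
  condI-unique : ∀ {as bs} → length as ≡ K * L → length bs ≡ K * L →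
                 CondI (suc K) (suc L) as → CondI (suc K) (suc L) bs → as ≡ bs
  condI-unique {as} {bs} la lb ca cb = nth-ext as bs (trans la (sym lb)) eq
    where
    eq : ∀ {m} → m < length as → nth as m ≡ nth bs m
    eq {m} m<n = subst (λ n → at as n ≡ at bs n) index
      (trans (ca (suc i) (suc j) (s≤s z≤n) i<L (s≤s z≤n) j<K) (sym (cb (suc i) (suc j) (s≤s z≤n) i<L (s≤s z≤n) j<K)))
      where
      i j : ℕ
      i = m % L
      j = m / L
      i<L : i < L
      i<L = m%n<n m L
      j<K : j < K
      j<K = m<n*o⇒m/o<n (subst (m <_) la m<n)
      index : j * L + suc i ≡ suc m
      index = trans (+-comm (j * L) (suc i)) (cong suc (sym (m≡m%n+[m/n]*n m L)))

  condII-unique : ∀ {as bs} → length as ≡ K * L → length bs ≡ K * L →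
                  CondII (suc K) (suc L) as → CondII (suc K) (suc L) bs → as ≡ bs
  condII-unique {as} {bs} la lb ca cb = nth-ext as bs (trans la (sym lb)) eq
    where
    eq : ∀ {m} → m < length as → nth as m ≡ nth bs m
    eq {m} m<n = subst (λ n → at as n ≡ at bs n) index
      (trans (ca (suc i) (suc j) (s≤s z≤n) i<L (s≤s z≤n) j<K) (sym (cb (suc i) (suc j) (s≤s z≤n) i<L (s≤s z≤n) j<K)))
      where
      i j : ℕ
      i = m / K
      j = m % K
      j<K : j < K
      j<K = m%n<n m K
      i<L : i < L
      i<L = m<n*o⇒m/o<n (subst (m <_) (trans la (*-comm K L)) m<n)
      index : i * K + suc j ≡ suc m
      index = trans (+-comm (i * K) (suc j)) (cong suc (sym (m≡m%n+[m/n]*n m K)))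

  length-tail : ∀ d → length (tail d) ≡ K * L
  length-tail d = length-applyUpTo (λ p → line d (suc p)) (K * L)

  isCycPerm-length : ∀ {as} → IsCycPerm (size (suc K) (suc L)) as → length as ≡ K * L
  isCycPerm-length perm = suc-injective (trans (↭-length perm)
    (trans (length-[1‥] (size (suc K) (suc L))) size≡N))

  conditions : ∀ as → IsCycPerm (size (suc K) (suc L)) as →
               InC (suc K) (suc L) as ⇔ (CondI (suc K) (suc L) as ⊎ CondII (suc K) (suc L) as)
  conditions as perm = mk⇔
    (λ c → [ (λ { refl → inj₂ tail-condII }) , (λ { refl → inj₁ tail-condI }) ]′ (∈C⇒tail c))
    [ (λ c → subst (InC (suc K) (suc L)) (sym (condI-unique (isCycPerm-length perm) (length-tail E) c tail-condI)) tail-E-∈C)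
    , (λ c → subst (InC (suc K) (suc L)) (sym (condII-unique (isCycPerm-length perm) (length-tail L) c tail-condII)) tail-L-∈C) ]′

  -- Here N = L + 1, so the slope is -1. Rotating by one moves the initial 1 to the end, where it
  -- continues the formula.
  tail-decreasing : K′ ≡ 0 → DecreasingCyc (1 ∷ tail L)
  tail-decreasing refl = 1 , subst (Linked _>_) (sym snoc) (Linked.applyUpTo⁺₁ f N descends)
    where
    f : ℕ → ℕ
    f p = line L (suc p)
    snoc : tail L ++ 1 ∷ [] ≡ applyUpTo f N
    snoc = trans (cong (λ v → tail L ++ suc v ∷ []) (sym (m*n%n≡0 L N))) (applyUpTo-∷ʳ f (K * L))
    N≡ : N ≡ suc L
    N≡ = cong suc (+-identityʳ L)
    value : ∀ {p} → p < N → L * suc p % N ≡ L ∸ p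
    value {p} p<N = %-unique N (L * suc p) 0 p (s≤s (≤-trans (m∸n≤m L p) (≤-reflexive (sym (+-identityʳ L)))))
      (subst (λ n → L * suc p + 0 ≡ L ∸ p + p * n) (sym N≡) (begin
        L * suc p + 0            ≡⟨ solve 2 (λ l p → l :* (con 1 :+ p) :+ con 0 := l :+ p :* l) refl L p ⟩
        L + p * L                ≡⟨ cong (_+ p * L) (sym (m∸n+n≡m {L} {p} (≤-pred (subst (p <_) N≡ p<N)))) ⟩
        L ∸ p + p + p * L        ≡⟨ solve 3 (λ x p l → x :+ p :+ p :* l := x :+ p :* (con 1 :+ l)) refl (L ∸ p) p L ⟩
        L ∸ p + p * suc L        ∎))
      where
      open ≡-Reasoning
      open +-*-Solver
    descends : ∀ {p} → suc p < N → f p > f (suc p)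
    descends {p} p<N = s≤s (subst₂ _<_ (sym (value p<N)) (sym (value (<⇒≤ p<N)))
      (∸-monoʳ-< (n<1+n p) (≤-pred (subst (suc p <_) N≡ p<N))))

  tail-increasing : L′ ≡ 0 → IncreasingCyc (1 ∷ tail L)
  tail-increasing refl = 0 , subst (Linked _<_) (sym (trans (++-identityʳ _) (∷-tail 1))) (Linked.applyUpTo⁺₁ (line 1) N ascends)
    where
    value : ∀ {p} → p < N → 1 * p % N ≡ p
    value {p} p<N = trans (cong (_% N) (*-identityˡ p)) (m<n⇒m%n≡m p<N)
    ascends : ∀ {p} → suc p < N → line 1 p < line 1 (suc p)
    ascends {p} p<N = s≤s (subst₂ _<_ (sym (value (<⇒≤ p<N))) (sym (value p<N)) (n<1+n p))

-- The cases k ≤ 2 or ℓ ≤ 2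

SmallCase : ℕ → ℕ → Set
SmallCase k ℓ = ∃ λ σ → IsCycPerm (size k ℓ) σ
  × (k ≤ 2 → DecreasingCyc (1 ∷ σ))
  × (3 ≤ k → IncreasingCyc (1 ∷ σ))
  × (∀ as → InC k ℓ as ⇔ as ≡ σ)

size-1 : ∀ k ℓ → 1 ≤ k → 1 ≤ ℓ → size k ℓ ≡ 1 → SmallCase k ℓ
size-1 k ℓ 1≤k 1≤ℓ size≡1 = [] , perm , (λ _ → 0 , [-]) , (λ _ → 0 , [-]) , λ as → mk⇔ (empty as) (λ { refl → mem })
  where
  perm : IsCycPerm (size k ℓ) []
  perm = subst (λ n → IsCycPerm n []) (sym size≡1) ↭-refl
  too-long : ∀ {m xs} → 1 ≤ m → xs ⊆ 1 ∷ [] → length xs ≢ suc m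
  too-long 1≤m sub len = <⇒≱ (s≤s 1≤m) (subst (_≤ 1) len (length-mono-≤ sub))
  mem : InC k ℓ []
  mem = perm , (λ (_ , sub , len , _) → too-long 1≤k sub len) , (λ (_ , sub , len , _) → too-long 1≤ℓ sub len)
  empty : ∀ as → InC k ℓ as → as ≡ []
  empty [] _ = refl
  empty (_ ∷ _) (perm , _) with () ← trans (↭-length perm) (cong (λ n → length [1‥ n ]) size≡1)

small-case : ∀ k ℓ → 1 ≤ k → 1 ≤ ℓ → k ≤ 2 ⊎ ℓ ≤ 2 → SmallCase k ℓ
small-case 1 ℓ 1≤k 1≤ℓ _ = size-1 1 ℓ 1≤k 1≤ℓ refl
small-case (suc (suc K′)) 1 1≤k 1≤ℓ _ = size-1 (suc (suc K′)) 1 1≤k 1≤ℓ (cong (_+ 1) (*-zeroʳ K′))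
small-case (suc (suc K′)) (suc (suc L′)) _ _ small =
  tail L , proj₁ tail-L-∈C ,
  (λ { (s≤s (s≤s K′≤0)) → tail-decreasing (n≤0⇒n≡0 K′≤0) }) ,
  (λ { (s≤s (s≤s 1≤K′)) → tail-increasing ([ (λ { (s≤s (s≤s K′≤0)) → contradiction K′≤0 (<⇒≱ 1≤K′) })
                                           , (λ { (s≤s (s≤s L′≤0)) → n≤0⇒n≡0 L′≤0 }) ]′ small) }) ,
  λ as → mk⇔ (λ c → [ (λ eq → eq) , (λ eq → trans eq (cong tail E≡L)) ]′ (∈C⇒tail c)) (λ { refl → tail-L-∈C })
  where
  open Linear K′ L′
  -- The two linear permutations coincide as soon as K = 1 or L = 1.
  E≡L : E ≡ L
  E≡L = [ (λ { (s≤s (s≤s z≤n)) → cong suc (*-identityʳ L′) }) , (λ { (s≤s (s≤s z≤n)) → refl }) ]′ small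

theorem3 : (k ℓ : ℕ) → 1 ≤ k → 1 ≤ ℓ →
    ((k ≤ 2 ⊎ ℓ ≤ 2) →
    ∃ λ σ → IsCycPerm (size k ℓ) σ
    × (k ≤ 2 → DecreasingCyc (1 ∷ σ))
    × (3 ≤ k → IncreasingCyc (1 ∷ σ))
    × (∀ as → InC k ℓ as ⇔ as ≡ σ))
    × ((3 ≤ k × 3 ≤ ℓ) →
    (∃ λ σ₁ → ∃ λ σ₂ → σ₁ ≢ σ₂ × (∀ as → InC k ℓ as ⇔ (as ≡ σ₁ ⊎ as ≡ σ₂)))
    × (∀ as → IsCycPerm (size k ℓ) as → InC k ℓ as ⇔ (CondI k ℓ as ⊎ CondII k ℓ as)))
theorem3 k ℓ 1≤k 1≤ℓ = small-case k ℓ 1≤k 1≤ℓ , large-case k ℓ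
  where
  large-case : ∀ k ℓ → 3 ≤ k × 3 ≤ ℓ →
    (∃ λ σ₁ → ∃ λ σ₂ → σ₁ ≢ σ₂ × (∀ as → InC k ℓ as ⇔ (as ≡ σ₁ ⊎ as ≡ σ₂)))
    × (∀ as → IsCycPerm (size k ℓ) as → InC k ℓ as ⇔ (CondI k ℓ as ⊎ CondII k ℓ as))
  large-case (suc (suc K′)) (suc (suc L′)) (s≤s (s≤s 1≤K′) , s≤s (s≤s 1≤L′)) =
    (tail L , tail E , tails-distinct 1≤K′ 1≤L′ , classification) , conditions
    where open Linear K′ L′
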